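{- For any graph $G$, the following assertions are equivalent. (a) $G$ is hereditarily equidominating. (b) $G$ is $\mathcal{F}$-free, where $\mathcal{F}=\{P_5,C_5,\mathit{bull},\mathit{banner},\mathit{house},K_{2,3},\overline{P_2\cup P_3}\}$. (c) One of the following holds: (i) $G$ is a basic graph; (ii) $G$ is obtained from a hereditarily equidominating graph by adding a universal vertex; (iii) $G$ is a chain-join of two hereditarily equidominating graphs.
   Context: All graphs are finite, simple and undirected; $\mathbb{N}=\{1,2,\dots\}$. A minimal dominating set (mds) of $G=(V,E)$ is an inclusion-minimal set $D\subseteq V$ such that every vertex is in $D$ or adjacent to a vertex of $D$. $G$ is equidominating if there exist $t\in\mathbb{N}$ and $w\colon V\to\mathbb{N}$ such that for all $D\subseteq V$: $D$ is an mds iff $\sum_{v\in D}w(v)=t$. $G$ is hereditarily equidominating if every induced subgraph of $G$ is equidominating. $G$ is $\mathcal{F}$-free if no induced subgraph of $G$ is isomorphic to a member of $\mathcal{F}$. $P_5$ and $C_5$ are the path and cycle on 5 vertices; the bull is a triangle $abc$ with pendant vertices attached to $a$ and to $b$ (edges $ab,ac,bc,ad,be$); the banner is a 4-cycle with one pendant vertex attached to one cycle vertex; the house is the complement of $P_5$ (a 4-cycle $abcd$ plus a vertex $e$ adjacent to $a$ and $b$); $K_{2,3}$ is the complete bipartite graph; $\overline{P_2\cup P_3}$ is the complement of the disjoint union of a path on 2 and a path on 3 vertices. A universal vertex is adjacent to all other vertices. For $n\ge 2$, $K_{2n}-ne$ is the graph obtained from the complete graph on $2n$ vertices by removing $n$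 pairwise disjoint edges. Basic graphs are $K_1$ and the graphs $K_{2n}-ne$ for $n\ge 2$. A chain graph is a bipartite graph in which the neighborhoods of the vertices of each side are pairwise comparable under inclusion. For disjoint graphs $G_1,G_2$ with $U_i$ the (possibly empty) set of universal vertices of $G_i$, and any chain graph $B$ with bipartition $U_1,U_2$, the graph $(G_1\cup G_2)+E(B)$ (disjoint union plus the edges of $B$) is called a chain-join of $G_1$ and $G_2$. -}

module Defs where

open import Data.Nat using (ℕ; zero; suc; _+_; _≡ᵇ_; _≥_; _/_)
open import Data.Bool using (Bool; true; false; not; _∧_; _∨_; if_then_else_)
open import Data.Bool.Properties using (∨-comm)
open import Data.Fin using (Fin; zero; suc; toℕ; splitAt)
open import Data.Fin.Subset using (Subset; _⊆_; _∈_)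
open import Data.Vec using (Vec; []; _∷_)
open import Data.List using (List; []; _∷_)
open import Data.Bool.ListAction using (any)
open import Data.Product using (Σ; ∃; _×_; _,_)
open import Data.Sum using (_⊎_; inj₁; inj₂)
open import Relation.Nullary using (¬_)
open import Relation.Binary.PropositionalEquality using (_≡_; _≢_; refl; cong; cong₂)
open import Function.Definitions using (Injective; Bijective)

record Graph (n : ℕ) : Set where
  field
    adj    : Fin n → Fin n → Bool
    sym    : ∀ i j → adj i j ≡ adj j i
    irrefl : ∀ i → adj i i ≡ false
open Graph public

≡ᵇ-sym : ∀ a b → (a ≡ᵇ b) ≡ (b ≡ᵇ a)
≡ᵇ-sym zero zero = refl
≡ᵇ-sym zero (suc b) = refl
≡ᵇ-sym (suc a) zero = refl
≡ᵇ-sym (suc a) (suc b) = ≡ᵇ-sym a b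

≡ᵇ-refl : ∀ a → (a ≡ᵇ a) ≡ true
≡ᵇ-refl zero = refl
≡ᵇ-refl (suc a) = ≡ᵇ-refl a

memE : ℕ → ℕ → List (ℕ × ℕ) → Bool
memE i j es = any (λ { (a , b) → (a ≡ᵇ i) ∧ (b ≡ᵇ j) }) es

fromEdges : (n : ℕ) → List (ℕ × ℕ) → Graph n
fromEdges n es = record
  { adj    = λ i j → not (toℕ i ≡ᵇ toℕ j) ∧ (memE (toℕ i) (toℕ j) es ∨ memE (toℕ j) (toℕ i) es)
  ; sym    = λ i j → cong₂ (λ x y → not x ∧ y) (≡ᵇ-sym (toℕ i) (toℕ j))
                        (∨-comm (memE (toℕ i) (toℕ j) es) (memE (toℕ j) (toℕ i) es))
  ; irrefl = λ i → cong (λ x → not x ∧ (memE (toℕ i) (toℕ i) es ∨ memE (toℕ i) (toℕ i) es))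
                        (≡ᵇ-refl (toℕ i))
  }

induced : ∀ {n m} → Graph n → (Fin m → Fin n) → Graph m
induced G f = record
  { adj    = λ i j → adj G (f i) (f j)
  ; sym    = λ i j → sym G (f i) (f j)
  ; irrefl = λ i → irrefl G (f i)
  }

Embeds : ∀ {k n} → Graph k → Graph n → Set
Embeds {k} {n} H G =
  Σ (Fin k → Fin n) λ f → Injective _≡_ _≡_ f × (∀ i j → adj G (f i) (f j) ≡ adj H i j)

Iso : ∀ {n k} → Graph n → Graph k → Set
Iso {n} {k} G H =
  Σ (Fin n → Fin k) λ f → Bijective _≡_ _≡_ f × (∀ i j → adj H (f i) (f j) ≡ adj G i j)

Dominating : ∀ {n} → Graph n → Subset n → Set
Dominating G D = ∀ v → v ∈ D ⊎ ∃ λ u → u ∈ D × adj G u v ≡ true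

MDS : ∀ {n} → Graph n → Subset n → Set
MDS G D = Dominating G D × (∀ D′ → D′ ⊆ D → Dominating G D′ → D ⊆ D′)

wsum : ∀ {n} → (Fin n → ℕ) → Subset n → ℕ
wsum w [] = 0
wsum w (b ∷ D) = (if b then w zero else 0) + wsum (λ i → w (suc i)) D

-- t ∈ ℕ = {1,2,...} and w : V → ℕ = {1,2,...}
Equidominating : ∀ {n} → Graph n → Set
Equidominating {n} G =
  Σ ℕ λ t → t ≥ 1 × Σ (Fin n → ℕ) λ w → (∀ v → w v ≥ 1) ×
    (∀ D → (MDS G D → wsum w D ≡ t) × (wsum w D ≡ t → MDS G D))

HerEquidominating : ∀ {n} → Graph n → Set
HerEquidominating {n} G =
  ∀ m (f : Fin (suc m) → Fin n) → Injective _≡_ _≡_ f → Equidominating (induced G f)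

P5 C5 bull banner house K23 coP2P3 : Graph 5
P5     = fromEdges 5 ((0 , 1) ∷ (1 , 2) ∷ (2 , 3) ∷ (3 , 4) ∷ [])
C5     = fromEdges 5 ((0 , 1) ∷ (1 , 2) ∷ (2 , 3) ∷ (3 , 4) ∷ (4 , 0) ∷ [])
bull   = fromEdges 5 ((0 , 1) ∷ (0 , 2) ∷ (1 , 2) ∷ (0 , 3) ∷ (1 , 4) ∷ [])
banner = fromEdges 5 ((0 , 1) ∷ (1 , 2) ∷ (2 , 3) ∷ (3 , 0) ∷ (0 , 4) ∷ [])
house  = fromEdges 5 ((0 , 1) ∷ (1 , 2) ∷ (2 , 3) ∷ (3 , 0) ∷ (4 , 0) ∷ (4 , 1) ∷ [])
K23    = fromEdges 5 ((0 , 2) ∷ (0 , 3) ∷ (0 , 4) ∷ (1 , 2) ∷ (1 , 3) ∷ (1 , 4) ∷ [])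
-- complement of P2 (0-1) ∪ P3 (2-3-4)
coP2P3 = fromEdges 5 ((0 , 2) ∷ (0 , 3) ∷ (0 , 4) ∷ (1 , 2) ∷ (1 , 3) ∷ (1 , 4) ∷ (2 , 4) ∷ [])

FFree : ∀ {n} → Graph n → Set
FFree G = ¬ Embeds P5 G × ¬ Embeds C5 G × ¬ Embeds bull G × ¬ Embeds banner G
        × ¬ Embeds house G × ¬ Embeds K23 G × ¬ Embeds coP2P3 G

K1 : Graph 1
K1 = record { adj = λ _ _ → false ; sym = λ _ _ → refl ; irrefl = λ _ → refl }

-- K_{2n} - n e on Fin (n + n): vertices 2k and 2k+1 form the removed pairs
K2n-ne : (n : ℕ) → Graph (n + n)
K2n-ne n = record
  { adj    = λ i j → not (toℕ i / 2 ≡ᵇ toℕ j / 2)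
  ; sym    = λ i j → cong not (≡ᵇ-sym (toℕ i / 2) (toℕ j / 2))
  ; irrefl = λ i → cong not (≡ᵇ-refl (toℕ i / 2))
  }

Basic : ∀ {n} → Graph n → Set
Basic G = Iso G K1 ⊎ Σ ℕ λ k → k ≥ 2 × Iso G (K2n-ne k)

addUniversal : ∀ {n} → Graph n → Graph (suc n)
addUniversal {n} G = record { adj = a ; sym = s ; irrefl = r }
  where
  a : Fin (suc n) → Fin (suc n) → Bool
  a zero zero = false
  a zero (suc j) = true
  a (suc i) zero = true
  a (suc i) (suc j) = adj G i j
  s : ∀ i j → a i j ≡ a j i
  s zero zero = refl
  s zero (suc j) = refl
  s (suc i) zero = refl
  s (suc i) (suc j) = sym G i j
  r : ∀ i → a i i ≡ false
  r zero = refl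
  r (suc i) = irrefl G i

Universal : ∀ {n} → Graph n → Fin n → Set
Universal G u = ∀ v → u ≢ v → adj G u v ≡ true

-- (G₁ ∪ G₂) + E(B), where B is given by its (bipartite) adjacency
-- between the vertices of G₁ (first block) and of G₂ (second block)
joinWith : ∀ {a b} → Graph a → Graph b → (Fin a → Fin b → Bool) → Graph (a + b)
joinWith {a} {b} G₁ G₂ B = record { adj = λ i j → c (splitAt a i) (splitAt a j) ; sym = λ i j → s (splitAt a i) (splitAt a j) ; irrefl = λ i → r (splitAt a i) }
  where
  c : Fin a ⊎ Fin b → Fin a ⊎ Fin b → Bool
  c (inj₁ x) (inj₁ y) = adj G₁ x y
  c (inj₂ x) (inj₂ y) = adj G₂ x y
  c (inj₁ x) (inj₂ y) = B x y
  c (inj₂ x) (inj₁ y) = B y x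
  s : ∀ p q → c p q ≡ c q p
  s (inj₁ x) (inj₁ y) = sym G₁ x y
  s (inj₂ x) (inj₂ y) = sym G₂ x y
  s (inj₁ x) (inj₂ y) = refl
  s (inj₂ x) (inj₁ y) = refl
  r : ∀ p → c p p ≡ false
  r (inj₁ x) = irrefl G₁ x
  r (inj₂ x) = irrefl G₂ x

IsChainGraphOnUniversals : ∀ {a b} → Graph a → Graph b → (Fin a → Fin b → Bool) → Set
IsChainGraphOnUniversals G₁ G₂ B =
    (∀ x y → B x y ≡ true → Universal G₁ x × Universal G₂ y)
  × (∀ x x′ → Universal G₁ x → Universal G₁ x′ →
       (∀ y → B x y ≡ true → B x′ y ≡ true) ⊎ (∀ y → B x′ y ≡ true → B x y ≡ true))
  × (∀ y y′ → Universal G₂ y → Universal G₂ y′ →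
       (∀ x → B x y ≡ true → B x y′ ≡ true) ⊎ (∀ x → B x y′ ≡ true → B x y ≡ true))

ConditionC : ∀ {n} → Graph n → Set
ConditionC G =
    Basic G
  ⊎ (Σ ℕ λ m → Σ (Graph (suc m)) λ H → HerEquidominating H × Iso G (addUniversal H))
  ⊎ (Σ ℕ λ a → Σ ℕ λ b → Σ (Graph (suc a)) λ G₁ → Σ (Graph (suc b)) λ G₂ →
       HerEquidominating G₁ × HerEquidominating G₂ ×
       Σ (Fin (suc a) → Fin (suc b) → Bool) λ B →
         IsChainGraphOnUniversals G₁ G₂ B × Iso G (joinWith G₁ G₂ B))

{-# OPTIONS --safe #-}

-- A forbidden graph has three minimal dominating sets A, B, C and another set D with
-- A + B = C + D as multisets, so D would get the weight of a minimal dominating set.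
-- Conversely, let G be free of the forbidden graphs. A vertex outside a 4-cycle sees all
-- or none of it. If two nonadjacent vertices a, d have no common neighbour, then G is
-- disconnected or a – b – c – d is a path, N[b] ∖ N[d] and N[c] ∖ N[a] cover G, and they
-- are the sides of a chain-join. Otherwise, if there is no universal vertex, every vertex
-- has exactly one nonneighbour: this is shown for a vertex with inclusion-maximal closed
-- neighbourhood, and then every vertex turns out to be such. Weights are obtained by
-- giving a universal vertex the whole target, by putting the weights of the two sides of
-- a chain-join in different digits of a large base, and by constant weights with target 2
-- for K₂ₙ − ne.
module Submission where

open import Defs
open import Data.Bool using (Bool; true; false; not; if_then_else_; T)
import Data.Bool.Properties as Bool
open import Data.Empty using (⊥; ⊥-elim)
open import Data.Fin using (Fin; zero; suc; toℕ; punchIn; punchOut; lift; splitAt; join; _↑ˡ_; _↑ʳ_)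
open import Data.Fin.Patterns using (0F; 1F; 2F; 3F; 4F; 5F; 6F)
open import Data.Fin.Properties
  using (_≟_; all?; any?; ¬∀⟶∃¬; punchIn-injective; punchInᵢ≢i; punchIn-punchOut; suc-injective;
        toℕ-injective; splitAt-↑ˡ; splitAt-↑ʳ; splitAt-join; join-splitAt)
open import Data.Fin.Subset using (Subset; _∈_; _⊆_; _⊂_; _⊃_; _∩_; _-_; inside; outside)
open import Data.Fin.Subset.Induction using (⊃-wellFounded)
open import Data.Fin.Subset.Properties
  using (_∈?_; anySubset?; p─q⊆p; x∈p⇒p-x⊂p; x∈p∧x≢y⇒x∈p-y; x∈p∩q⁺; x∈p∩q⁻)
open import Data.List using (List; []; _∷_)
open import Data.List.Membership.Propositional renaming (_∈_ to _∈L_)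
open import Data.List.Relation.Unary.All as All using (All; []; _∷_)
open import Data.List.Relation.Unary.Any renaming (any? to anyL?) using ()
open import Data.Nat as ℕ using (ℕ; zero; suc; _+_; _*_; _≤_; _<_; _≥_; z≤n; s≤s; _/_; _%_; _≡ᵇ_)
open import Data.Nat.DivMod using (m≡m%n+[m/n]*n; m%n<n; +-distrib-/-∣ˡ; [m+kn]%n≡m%n; m<n⇒m%n≡m)
open import Data.Nat.Divisibility using (∣-refl)
open import Data.Nat.Induction using (<-wellFounded)
open import Data.Nat.Properties
  using (+-*-semiring; +-identityʳ; +-suc; +-comm; +-assoc; +-cancelˡ-≡; *-comm; *-cancelˡ-≡;
        *-distribʳ-+; m+n≡0⇒m≡0; m+n≡0⇒n≡0; m≤m+n; m≤n+m; ≤-trans; ≤-refl; ≤-reflexive; +-mono-≤;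
        *-mono-≤; m<m+n; m<n+m; n<1+n; ≡ᵇ⇒≡)
open import Data.Product using (∃; ∃₂; _×_; _,_; proj₁; proj₂)
open import Data.Product.Properties using (≡-dec)
open import Data.Sum as Sum using (_⊎_; inj₁; inj₂; [_,_]′)
open import Data.Vec using ([]; _∷_; lookup; tabulate)
open import Data.Vec.Functional using (insertAt)
open import Data.Vec.Functional.Properties using (insertAt-lookup; insertAt-punchIn)
open import Data.Vec.Properties using (lookup⇒[]=; []=⇒lookup; lookup∘tabulate)
open import Function using (_∘_; id)
open import Function.Bundles using (_⇔_; mk⇔)
open import Function.Definitions using (Injective)
open import Induction.WellFounded using (Acc; acc)
open import Relation.Nullary using (¬_; Dec; yes; no; does; contradiction)
open import Relation.Nullary.Decidable
  using (from-yes; dec-true; dec-false; _×-dec_; _⊎-dec_; _→-dec_; ¬?; decidable-stable)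
open import Relation.Unary using (Decidable)
open import Algebra.Properties.Semiring.Sum +-*-semiring
  using (sum; sum-cong-≗; sum-remove; *-distribˡ-sum; sum-replicate-zero; ∑-distrib-+)
open import Relation.Binary.PropositionalEquality using (_≡_; _≢_; refl; trans; cong; cong₂; subst) renaming (sym to ≡-sym)

-- Forbidden subgraphs

-- Separate digits for the two sides of a chain-join work only if its minimal dominating sets are
-- the unions of one from each side. This fails in general: K₂ is a chain-join of two single
-- vertices, and either vertex alone dominates it. It holds if each side has a vertex with no
-- neighbour across, and the chain-joins found in graphs without forbidden subgraphs have such
-- vertices (`Split`). For arbitrary chain-joins the way from (c) to (a) therefore leads through
-- (b). There a finite check suffices: a chain-join induces on every vertex subset a chain-join
-- whose sides may be empty, and no bipartition of a forbidden graph into two nonempty parts has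
-- this form.

Forbidden : Fin 7 → Graph 5
Forbidden 0F = P5
Forbidden 1F = C5
Forbidden 2F = bull
Forbidden 3F = banner
Forbidden 4F = house
Forbidden 5F = K23
Forbidden 6F = coP2P3

Free : ∀ {n} → Graph n → Set
Free G = ∀ k → ¬ Embeds (Forbidden k) G

FFree⇒Free : ∀ {n} (G : Graph n) → FFree G → Free G
FFree⇒Free G (p , _) 0F = p
FFree⇒Free G (_ , p , _) 1F = p
FFree⇒Free G (_ , _ , p , _) 2F = p
FFree⇒Free G (_ , _ , _ , p , _) 3F = p
FFree⇒Free G (_ , _ , _ , _ , p , _) 4F = p
FFree⇒Free G (_ , _ , _ , _ , _ , p , _) 5F = p
FFree⇒Free G (_ , _ , _ , _ , _ , _ , p) 6F = p

Free⇒FFree : ∀ {n} (G : Graph n) → Free G → FFree G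
Free⇒FFree G p = p 0F , p 1F , p 2F , p 3F , p 4F , p 5F , p 6F

bool-cases : ∀ b → b ≡ true ⊎ b ≡ false
bool-cases true  = inj₁ refl
bool-cases false = inj₂ refl

true≢false : ∀ {b} → b ≡ true → b ≡ false → ⊥
true≢false refl ()

does⁻ : ∀ {P : Set} (P? : Dec P) → does P? ≡ true → P
does⁻ (yes p) _ = p

SameRow : ∀ {n} → Graph n → Fin n → Fin n → Set
SameRow H i j = ∀ k → adj H i k ≡ adj H j k

-- Since an embedding only has to be checked for injectivity on false twins, it is
-- enough to list these.
TwinsAmong : Graph 5 → List (Fin 5 × Fin 5) → Set
TwinsAmong H tw = ∀ i j → SameRow H i j → i ≡ j ⊎ ((i , j) ∈L tw ⊎ (j , i) ∈L tw)

twinsAmong? : ∀ H tw → Dec (TwinsAmong H tw)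
twinsAmong? H tw = all? λ i → all? λ j →
  all? (λ k → adj H i k Bool.≟ adj H j k) →-dec
  ((i ≟ j) ⊎-dec (anyL? (≡-dec _≟_ _≟_ (i , j)) tw ⊎-dec anyL? (≡-dec _≟_ _≟_ (j , i)) tw))

embed₅ : ∀ {n} (G : Graph n) (H : Graph 5) {tw} → TwinsAmong H tw →
  ∀ a b c d e → let f = lookup (a ∷ b ∷ c ∷ d ∷ e ∷ []) in
  All (λ (i , j) → f i ≢ f j) tw →
  adj G a b ≡ adj H 0F 1F → adj G a c ≡ adj H 0F 2F → adj G a d ≡ adj H 0F 3F → adj G a e ≡ adj H 0F 4F →
  adj G b c ≡ adj H 1F 2F → adj G b d ≡ adj H 1F 3F → adj G b e ≡ adj H 1F 4F →
  adj G c d ≡ adj H 2F 3F → adj G c e ≡ adj H 2F 4F →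
  adj G d e ≡ adj H 3F 4F → Embeds H G
embed₅ G H twins a b c d e distinct ab ac ad ae bc bd be cd ce de = f , injective , agree
  where
  f = lookup (a ∷ b ∷ c ∷ d ∷ e ∷ [])

  loop : ∀ i → adj G (f i) (f i) ≡ adj H i i
  loop i = trans (irrefl G (f i)) (≡-sym (irrefl H i))

  swap : ∀ i j → adj G (f i) (f j) ≡ adj H i j → adj G (f j) (f i) ≡ adj H j i
  swap i j p = trans (sym G (f j) (f i)) (trans p (sym H i j))

  agree : ∀ i j → adj G (f i) (f j) ≡ adj H i j
  agree 0F 0F = loop 0F
  agree 0F 1F = ab
  agree 0F 2F = ac
  agree 0F 3F = ad
  agree 0F 4F = ae
  agree 1F 0F = swap 0F 1F ab
  agree 1F 1F = loop 1F
  agree 1F 2F = bc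
  agree 1F 3F = bd
  agree 1F 4F = be
  agree 2F 0F = swap 0F 2F ac
  agree 2F 1F = swap 1F 2F bc
  agree 2F 2F = loop 2F
  agree 2F 3F = cd
  agree 2F 4F = ce
  agree 3F 0F = swap 0F 3F ad
  agree 3F 1F = swap 1F 3F bd
  agree 3F 2F = swap 2F 3F cd
  agree 3F 3F = loop 3F
  agree 3F 4F = de
  agree 4F 0F = swap 0F 4F ae
  agree 4F 1F = swap 1F 4F be
  agree 4F 2F = swap 2F 4F ce
  agree 4F 3F = swap 3F 4F de
  agree 4F 4F = loop 4F

  injective : Injective _≡_ _≡_ f
  injective {i} {j} fi≡fj
    with twins i j (λ k → trans (≡-sym (agree i k)) (trans (cong (λ x → adj G x (f k)) fi≡fj) (agree j k)))
  ... | inj₁ i≡j        = i≡j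
  ... | inj₂ (inj₁ ij∈) = contradiction fi≡fj (All.lookup distinct ij∈)
  ... | inj₂ (inj₂ ji∈) = contradiction (≡-sym fi≡fj) (All.lookup distinct ji∈)

-- Structure of graphs without forbidden subgraphs

-- Side `true` is the left one. The anchors `left` and `right` keep both sides nonempty and force
-- every dominating set to meet each side. That neighbourhoods across are nested is derived later,
-- in `comparable`.
record Split {n} (G : Graph n) : Set where
  field
    side          : Fin n → Bool
    left right    : Fin n
    left-side     : side left ≡ true
    right-side    : side right ≡ false
    left-private  : ∀ y → side y ≡ false → adj G left y ≡ false
    right-private : ∀ x → side x ≡ true → adj G x right ≡ false
    cross-left    : ∀ {x y} → side x ≡ true → side y ≡ false → adj G x y ≡ true →
                    ∀ z → side z ≡ true → x ≢ z → adj G x z ≡ true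
    cross-right   : ∀ {x y} → side x ≡ true → side y ≡ false → adj G x y ≡ true →
                    ∀ z → side z ≡ false → y ≢ z → adj G y z ≡ true

Mate : ∀ {n} → Graph n → Fin n → Fin n → Set
Mate G v r = v ≢ r × adj G v r ≡ false × (∀ u → v ≢ u → adj G v u ≡ false → u ≡ r)

data Structure {n} (G : Graph n) : Set where
  universal : ∀ u → Universal G u → Structure G
  split     : Split G → Structure G
  -- The neighbour `p` excludes two isolated vertices, which would be K₂ₙ - ne with n = 1.
  matched   : (∀ v → ∃ λ r → Mate G v r × ∃ λ p → adj G v p ≡ true) → Structure G

module Decomposition {n} (G : Graph n) (free : Free G) where

  infix 4 _~_ _≁_

  _~_ _≁_ : Fin n → Fin n → Set
  x ~ y = adj G x y ≡ true
  x ≁ y = adj G x y ≡ false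

  _~?_ : ∀ x y → Dec (x ~ y)
  x ~? y = adj G x y Bool.≟ true

  _≁?_ : ∀ x y → Dec (x ≁ y)
  x ≁? y = adj G x y Bool.≟ false

  ~-or-≁ : ∀ x y → x ~ y ⊎ x ≁ y
  ~-or-≁ x y = bool-cases (adj G x y)

  ~-sym : ∀ {x y} → x ~ y → y ~ x
  ~-sym {x} {y} = trans (sym G y x)

  ≁-sym : ∀ {x y} → x ≁ y → y ≁ x
  ≁-sym {x} {y} = trans (sym G y x)

  ~⇒¬≁ : ∀ {x y} → x ~ y → x ≁ y → ⊥
  ~⇒¬≁ = true≢false

  ¬~⇒≁ : ∀ {x y} → ¬ x ~ y → x ≁ y
  ¬~⇒≁ = Bool.¬-not

  ~⇒≢ : ∀ {x y} → x ~ y → x ≢ y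
  ~⇒≢ {x} x~x refl = ~⇒¬≁ x~x (irrefl G x)

  separated : ∀ {x y} z → x ~ z → y ≁ z → x ≢ y
  separated z x~z y≁z refl = ~⇒¬≁ x~z y≁z

  separated′ : ∀ {x y} z → x ≁ z → y ~ z → x ≢ y
  separated′ z x≁z y~z refl = ~⇒¬≁ y~z x≁z

  noP5 : ∀ a b c d e →
    a ~ b → a ≁ c → a ≁ d → a ≁ e → b ~ c → b ≁ d → b ≁ e → c ~ d → c ≁ e → d ~ e → ⊥
  noP5 a b c d e ab ac ad ae bc bd be cd ce de =
    free 0F (embed₅ G P5 {[]} (from-yes (twinsAmong? P5 [])) a b c d e [] ab ac ad ae bc bd be cd ce de)

  noC5 : ∀ a b c d e →
    a ~ b → a ≁ c → a ≁ d → a ~ e → b ~ c → b ≁ d → b ≁ e → c ~ d → c ≁ e → d ~ e → ⊥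
  noC5 a b c d e ab ac ad ae bc bd be cd ce de =
    free 1F (embed₅ G C5 {[]} (from-yes (twinsAmong? C5 [])) a b c d e [] ab ac ad ae bc bd be cd ce de)

  noBull : ∀ a b c d e →
    a ~ b → a ~ c → a ~ d → a ≁ e → b ~ c → b ≁ d → b ~ e → c ≁ d → c ≁ e → d ≁ e → ⊥
  noBull a b c d e ab ac ad ae bc bd be cd ce de =
    free 2F (embed₅ G bull {[]} (from-yes (twinsAmong? bull [])) a b c d e [] ab ac ad ae bc bd be cd ce de)

  noBanner : ∀ a b c d e → b ≢ d →
    a ~ b → a ≁ c → a ~ d → a ~ e → b ~ c → b ≁ d → b ≁ e → c ~ d → c ≁ e → d ≁ e → ⊥
  noBanner a b c d e b≢d ab ac ad ae bc bd be cd ce de =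
    free 3F (embed₅ G banner {(1F , 3F) ∷ []} (from-yes (twinsAmong? banner ((1F , 3F) ∷ []))) a b c d e
      (b≢d ∷ []) ab ac ad ae bc bd be cd ce de)

  noHouse : ∀ a b c d e →
    a ~ b → a ≁ c → a ~ d → a ~ e → b ~ c → b ≁ d → b ~ e → c ~ d → c ≁ e → d ≁ e → ⊥
  noHouse a b c d e ab ac ad ae bc bd be cd ce de =
    free 4F (embed₅ G house {[]} (from-yes (twinsAmong? house [])) a b c d e [] ab ac ad ae bc bd be cd ce de)

  noK23 : ∀ a b c d e → a ≢ b → c ≢ d → c ≢ e → d ≢ e →
    a ≁ b → a ~ c → a ~ d → a ~ e → b ~ c → b ~ d → b ~ e → c ≁ d → c ≁ e → d ≁ e → ⊥
  noK23 a b c d e a≢b c≢d c≢e d≢e ab ac ad ae bc bd be cd ce de =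
    free 5F (embed₅ G K23 {(0F , 1F) ∷ (2F , 3F) ∷ (2F , 4F) ∷ (3F , 4F) ∷ []}
      (from-yes (twinsAmong? K23 ((0F , 1F) ∷ (2F , 3F) ∷ (2F , 4F) ∷ (3F , 4F) ∷ [])))
      a b c d e (a≢b ∷ c≢d ∷ c≢e ∷ d≢e ∷ []) ab ac ad ae bc bd be cd ce de)

  noCoP2P3 : ∀ a b c d e → a ≢ b →
    a ≁ b → a ~ c → a ~ d → a ~ e → b ~ c → b ~ d → b ~ e → c ≁ d → c ~ e → d ≁ e → ⊥
  noCoP2P3 a b c d e a≢b ab ac ad ae bc bd be cd ce de =
    free 6F (embed₅ G coP2P3 {(0F , 1F) ∷ []} (from-yes (twinsAmong? coP2P3 ((0F , 1F) ∷ []))) a b c d e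
      (a≢b ∷ []) ab ac ad ae bc bd be cd ce de)

  -- Induced 4-cycles

  record C4 (a b c d : Fin n) : Set where
    constructor mkC4
    field
      ab  : a ~ b
      bc  : b ~ c
      cd  : c ~ d
      da  : d ~ a
      ac  : a ≁ c
      bd  : b ≁ d
      a≢c : a ≢ c
      b≢d : b ≢ d

  rotate : ∀ {a b c d} → C4 a b c d → C4 b c d a
  rotate (mkC4 ab bc cd da ac bd a≢c b≢d) = mkC4 bc cd da ab bd (≁-sym ac) b≢d (a≢c ∘ ≡-sym)

  -- The neighbours of `v` on the cycle decide the forbidden graph: `a` alone gives a banner, two
  -- consecutive vertices a house, two opposite ones K₂,₃, and three the complement of P₂ ∪ P₃.
  C4-module : ∀ {a b c d v} → C4 a b c d → v ~ a → v ≢ b → v ≢ d → v ~ b × v ~ c × v ~ d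
  C4-module {a} {b} {c} {d} {v} (mkC4 ab bc cd da ac bd a≢c b≢d) va v≢b v≢d
    with ~-or-≁ v b | ~-or-≁ v c | ~-or-≁ v d
  ... | inj₁ vb | inj₁ vc | inj₁ vd = vb , vc , vd
  ... | inj₂ vb | inj₂ vc | inj₂ vd = ⊥-elim (noBanner a b c d v b≢d ab ac (~-sym da) (~-sym va) bc bd (≁-sym vb) cd (≁-sym vc) (≁-sym vd))
  ... | inj₁ vb | inj₂ vc | inj₂ vd = ⊥-elim (noHouse a b c d v ab ac (~-sym da) (~-sym va) bc bd (~-sym vb) cd (≁-sym vc) (≁-sym vd))
  ... | inj₂ vb | inj₂ vc | inj₁ vd = ⊥-elim (noHouse a d c b v (~-sym da) ac ab (~-sym va) (~-sym cd) (≁-sym bd) (~-sym vd) (~-sym bc) (≁-sym vc) (≁-sym vb))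
  ... | inj₂ vb | inj₁ vc | inj₂ vd = ⊥-elim (noK23 a c b d v a≢c b≢d (v≢b ∘ ≡-sym) (v≢d ∘ ≡-sym) ac ab (~-sym da) (~-sym va) (~-sym bc) cd (~-sym vc) bd (≁-sym vb) (≁-sym vd))
  ... | inj₁ vb | inj₁ vc | inj₂ vd = ⊥-elim (noCoP2P3 a c b d v a≢c ac ab (~-sym da) (~-sym va) (~-sym bc) cd (~-sym vc) bd (~-sym vb) (≁-sym vd))
  ... | inj₁ vb | inj₂ vc | inj₁ vd = ⊥-elim (noCoP2P3 b d a c v b≢d bd (~-sym ab) bc (~-sym vb) da (~-sym cd) (~-sym vd) ac (~-sym va) (≁-sym vc))
  ... | inj₂ vb | inj₁ vc | inj₁ vd = ⊥-elim (noCoP2P3 a c d b v a≢c ac (~-sym da) ab (~-sym va) cd (~-sym bc) (~-sym vc) (≁-sym bd) (~-sym vd) (≁-sym vb))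

  module _ {P : Fin n → Set} (P? : Decidable P) where

    side? : Fin n → Bool
    side? v = does (P? v)

    side-true : ∀ {v} → P v → side? v ≡ true
    side-true {v} p = dec-true (P? v) p

    side-true⁻ : ∀ {v} → side? v ≡ true → P v
    side-true⁻ {v} = does⁻ (P? v)

    side-false : ∀ {v} → ¬ P v → side? v ≡ false
    side-false {v} = dec-false (P? v)

    side-false⁻ : ∀ {v} → side? v ≡ false → ¬ P v
    side-false⁻ eq p = true≢false (side-true p) eq

    -- A union of components has no edges leaving it, so every condition on crossing edges is
    -- vacuous and any two vertices can be the anchors.
    closed⇒split : (∀ {u v} → P u → u ~ v → P v) → ∀ {a d} → P a → ¬ P d → Split G
    closed⇒split closed {a} {d} Pa ¬Pd = record
      { side          = side?
      ; left          = a
      ; right         = d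
      ; left-side     = side-true Pa
      ; right-side    = side-false ¬Pd
      ; left-private  = λ y y∉ → ¬~⇒≁ λ a~y → no-cross (side-true Pa) y∉ a~y
      ; right-private = λ x x∈ → ¬~⇒≁ λ x~d → no-cross x∈ (side-false ¬Pd) x~d
      ; cross-left    = λ x∈ y∉ x~y → ⊥-elim (no-cross x∈ y∉ x~y)
      ; cross-right   = λ x∈ y∉ x~y → ⊥-elim (no-cross x∈ y∉ x~y)
      }
      where
      no-cross : ∀ {x y} → side? x ≡ true → side? y ≡ false → x ~ y → ⊥
      no-cross x∈ y∉ x~y = side-false⁻ y∉ (closed (side-true⁻ x∈) x~y)

  -- Nonadjacent vertices without a common neighbour

  record Distant (a b c d : Fin n) : Set where
    constructor mkDistant
    field
      ab   : a ~ b
      bc   : b ~ c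
      cd   : c ~ d
      ac   : a ≁ c
      bd   : b ≁ d
      ad   : a ≁ d
      far  : ∀ x → x ~ a → x ~ d → ⊥

  reverse : ∀ {a b c d} → Distant a b c d → Distant d c b a
  reverse (mkDistant ab bc cd ac bd ad far) =
    mkDistant (~-sym cd) (~-sym bc) (~-sym ab) (≁-sym bd) (≁-sym ac) (≁-sym ad) (λ x xd xa → far x xa xd)

  -- For `Distant a b c d` this is N[b] ∖ N[d]: `v ≁ d` admits `v ≡ d` too, but `d` is neither `b`
  -- nor a neighbour of `b`.
  Near : Fin n → Fin n → Fin n → Set
  Near b d v = (v ≡ b ⊎ v ~ b) × v ≁ d

  near? : ∀ b d → Decidable (Near b d)
  near? b d v = ((v ≟ b) ⊎-dec (v ~? b)) ×-dec (v ≁? d)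

  Remote : Fin n → Fin n → Fin n → Fin n → Fin n → Set
  Remote a b c d v = v ≁ a × v ≁ b × v ≁ c × v ≁ d

  module _ {a b c d} (D : Distant a b c d) where
    open Distant D

    b≢d : b ≢ d
    b≢d = separated a (~-sym ab) (≁-sym ad)

    -- A vertex that is in no near set but sees the path would see only one end (P₅), both ends
    -- (excluded by `far`), or just two alternate vertices. In the last case it closes a 4-cycle
    -- with the path, and the end of the path off this cycle sees only part of it.
    classify : ∀ v → Near b d v ⊎ Near c a v ⊎ Remote a b c d v
    classify v with v ≟ b | v ≟ c
    ... | yes refl | _ = inj₁ (inj₁ refl , bd)
    ... | no _ | yes refl = inj₂ (inj₁ (inj₁ refl , ≁-sym ac))
    ... | no v≢b | no v≢c with ~-or-≁ v a | ~-or-≁ v b | ~-or-≁ v c | ~-or-≁ v d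
    ...   | _       | inj₁ vb | _       | inj₂ vd = inj₁ (inj₂ vb , vd)
    ...   | inj₂ va | _       | inj₁ vc | _       = inj₂ (inj₁ (inj₂ vc , va))
    ...   | inj₁ va | _       | _       | inj₁ vd = ⊥-elim (far v va vd)
    ...   | inj₂ va | inj₁ vb | inj₂ vc | inj₁ vd =
      ⊥-elim (~⇒¬≁ (proj₁ (C4-module (mkC4 (~-sym vb) vd (~-sym cd) (~-sym bc) bd vc b≢d v≢c) ab
        (separated′ d ad vd) (separated′ d ad cd))) (≁-sym va))
    ...   | inj₁ va | inj₂ vb | inj₁ vc | inj₂ vd =
      ⊥-elim (~⇒¬≁ (proj₁ (C4-module (mkC4 (~-sym bc) (~-sym ab) (~-sym va) vc (≁-sym ac) (≁-sym vb) (separated d cd ad) (v≢b ∘ ≡-sym)) (~-sym cd)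
        (separated′ a (≁-sym ad) (~-sym ab)) (separated′ a (≁-sym ad) va))) (≁-sym bd))
    ...   | inj₁ va | inj₂ vb | inj₂ vc | inj₂ vd = ⊥-elim (noP5 v a b c d va vb vc vd ab ac ad bc bd cd)
    ...   | inj₂ va | inj₂ vb | inj₂ vc | inj₁ vd =
      ⊥-elim (noP5 a b c d v ab ac ad (≁-sym va) bc bd (≁-sym vb) cd (≁-sym vc) (~-sym vd))
    ...   | inj₂ va | inj₂ vb | inj₂ vc | inj₂ vd = inj₂ (inj₂ (va , vb , vc , vd))

    -- According to whether `x` sees `c`, the vertices `v`, `x`, `b`, `c`, `d` induce a bull or a
    -- P₅.
    remote-near : ∀ {v x} → Remote a b c d v → Near b d x → v ~ x → ⊥
    remote-near (_ , vb , _) (inj₁ refl , _) vx = ~⇒¬≁ vx vb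
    remote-near {v} {x} (va , vb , vc , vd) (inj₂ xb , xd) vx with ~-or-≁ x c
    ... | inj₂ xc = noP5 v x b c d vx vb vc vd xb xc xd bc bd cd
    ... | inj₁ xc = noBull x c b v d xc xb (~-sym vx) xd (~-sym bc) (≁-sym vc) cd (≁-sym vb) bd vd

    -- Otherwise the triangle `b`, `c`, `x` with pendants `a` at `b` and `d` at `c` is a bull.
    near-c⇒~a : ∀ {x} → Near b d x → x ~ c → x ~ a
    near-c⇒~a (inj₁ refl , _) _ = ~-sym ab
    near-c⇒~a {x} (inj₂ xb , xd) xc with ~-or-≁ x a
    ... | inj₁ xa = xa
    ... | inj₂ xa = ⊥-elim (noBull b c x a d bc (~-sym xb) (~-sym ab) bd (~-sym xc) (≁-sym ac) cd xa xd ad)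

  remote-near′ : ∀ {a b c d v x} → Distant a b c d → Remote a b c d v → Near c a x → v ~ x → ⊥
  remote-near′ D (va , vb , vc , vd) = remote-near (reverse D) (vd , vc , vb , va)

  near-b⇒~d : ∀ {a b c d y} → Distant a b c d → Near c a y → y ~ b → y ~ d
  near-b⇒~d D = near-c⇒~a (reverse D)

  -- Suppose `y` misses `z`. If `z ≁ b`, the triangle `b`, `c`, `y` with pendants `a` and `z` is a
  -- bull. If `z ~ b`, then `b`, `y`, `d`, `z` is a 4-cycle of which `a` sees only `b`.
  near-b⇒universal : ∀ {a b c d y} → Distant a b c d → Near c a y → y ~ b →
                     ∀ {z} → Near c a z → y ≢ z → y ~ z
  near-b⇒universal D (inj₁ refl , _) yb (inj₁ refl , _) y≢z = ⊥-elim (y≢z refl)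
  near-b⇒universal D (inj₁ refl , _) yb (inj₂ zc , _) _ = ~-sym zc
  near-b⇒universal D (inj₂ yc , _) yb (inj₁ refl , _) _ = yc
  near-b⇒universal {a} {b} {c} {d} {y} D By@(inj₂ yc , ya) yb {z} Bz@(inj₂ zc , za) y≢z with ~-or-≁ y z
  ... | inj₁ yz = yz
  ... | inj₂ yz with ~-or-≁ z b
  ...   | inj₂ zb = ⊥-elim (noBull b c y a z bc (~-sym yb) (~-sym ab) (≁-sym zb) (~-sym yc) (≁-sym ac) (~-sym zc) ya yz (≁-sym za))
    where open Distant D
  ...   | inj₁ zb =
    ⊥-elim (~⇒¬≁ (proj₁ (C4-module (mkC4 (~-sym yb) yd (~-sym zd) zb bd yz (b≢d D) y≢z) ab
      (separated′ d ad yd) (separated′ d ad zd))) (≁-sym ya))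
    where
    open Distant D
    yd = near-b⇒~d D By yb
    zd = near-b⇒~d D Bz zb

  near-c⇒universal : ∀ {a b c d x} → Distant a b c d → Near b d x → x ~ c →
                     ∀ {z} → Near b d z → x ≢ z → x ~ z
  near-c⇒universal D = near-b⇒universal (reverse D)

  -- Suppose `x` misses `z`. If `z ≁ y`, the triangle `b`, `y`, `x` with pendants `z` and `d` is a
  -- bull. If `z ~ y`, both `x` and `z` see `a`, and `y`, `z`, `a`, `x` is a 4-cycle of which `d`
  -- sees only `y`.
  cross-b⇒universal : ∀ {a b c d x y} → Distant a b c d → Near b d x → Near c a y → x ~ y → y ~ b →
                      ∀ {z} → Near b d z → x ≢ z → x ~ z
  cross-b⇒universal D (inj₁ refl , _) By xy yb (inj₁ refl , _) x≢z = ⊥-elim (x≢z refl)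
  cross-b⇒universal D (inj₁ refl , _) By xy yb (inj₂ zb , _) x≢z = ~-sym zb
  cross-b⇒universal D (inj₂ xb , _) By xy yb (inj₁ refl , _) x≢z = xb
  cross-b⇒universal {a} {b} {c} {d} {x} {y} D Ax@(inj₂ xb , xd) By@(_ , ya) xy yb {z} Az@(inj₂ zb , zd) x≢z
    with ~-or-≁ x z
  ... | inj₁ xz = xz
  ... | inj₂ xz with ~-or-≁ z y
  ...   | inj₂ zy = ⊥-elim (noBull b y x z d (~-sym yb) (~-sym xb) (~-sym zb) bd (~-sym xy) (≁-sym zy) yd xz xd zd)
    where
    open Distant D
    yd = near-b⇒~d D By yb
  ...   | inj₁ zy =
    ⊥-elim (~⇒¬≁ (proj₁ (proj₂ (C4-module (mkC4 (~-sym zy) za (~-sym xa) xy ya (≁-sym xz) (separated d yd ad) (x≢z ∘ ≡-sym)) (~-sym yd)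
      (separated′ b (≁-sym bd) zb) (separated′ b (≁-sym bd) xb)))) (≁-sym ad))
    where
    open Distant D
    yd = near-b⇒~d D By yb
    adjacent-a : ∀ {w} → w ~ b → w ≁ d → w ~ y → w ~ a
    adjacent-a {w} wb wd wy with ~-or-≁ w a
    ... | inj₁ wa = wa
    ... | inj₂ wa = ⊥-elim (noBull b y w a d (~-sym yb) (~-sym wb) (~-sym ab) bd (~-sym wy) ya yd wa wd ad)
    xa = adjacent-a xb xd xy
    za = adjacent-a zb zd zy

  cross-c⇒universal : ∀ {a b c d x y} → Distant a b c d → Near b d x → Near c a y → x ~ y → x ~ c →
                      ∀ {z} → Near c a z → y ≢ z → y ~ z
  cross-c⇒universal D Ax By xy xc = cross-b⇒universal (reverse D) By Ax (~-sym xy) xc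

  -- Otherwise `b`, `c`, `y`, `x` is an induced 4-cycle, and `a` sees `b` but not `c`. This reduces
  -- every crossing edge to one whose end sees the opposite centre, the case treated by the
  -- preceding lemmas.
  cross-adjacent : ∀ {a b c d x y} → Distant a b c d → Near b d x → Near c a y → x ~ y → y ~ b ⊎ x ~ c
  cross-adjacent D (inj₁ refl , _) _ xy = inj₁ (~-sym xy)
  cross-adjacent D _ (inj₁ refl , _) xy = inj₂ xy
  cross-adjacent {a} {b} {c} {d} {x} {y} D (inj₂ xb , xd) (inj₂ yc , ya) xy with ~-or-≁ y b | ~-or-≁ x c
  ... | inj₁ yb | _       = inj₁ yb
  ... | _       | inj₁ xc = inj₂ xc
  ... | inj₂ yb | inj₂ xc =
    ⊥-elim (~⇒¬≁ (proj₁ (C4-module (mkC4 bc (~-sym yc) (~-sym xy) xb (≁-sym yb) (≁-sym xc) (separated a (~-sym ab) ya) (separated d cd xd)) ab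
      (separated′ d ad cd) (separated′ y (≁-sym ya) xy))) ac)
    where open Distant D

  distant⇒split : ∀ {a b c d} → Distant a b c d → Split G
  distant⇒split {a} {b} {c} {d} D
    with all? (λ v → near? b d v ⊎-dec near? c a v)
  -- Some vertex is remote from the path. Remote vertices see no near vertex, so the two near sets
  -- together are a union of components.
  ... | no ¬all = closed⇒split W? closed (inj₁ (inj₂ ab , ad)) ¬Wr
    where
    open Distant D
    W : Fin n → Set
    W v = Near b d v ⊎ Near c a v
    W? : Decidable W
    W? v = near? b d v ⊎-dec near? c a v
    closed : ∀ {u v} → W u → u ~ v → W v
    closed {u} {v} Wu uv with classify D v
    ... | inj₁ p = inj₁ p
    ... | inj₂ (inj₁ p) = inj₂ p
    closed (inj₁ Au) uv | inj₂ (inj₂ r) = ⊥-elim (remote-near D r Au (~-sym uv))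
    closed (inj₂ Bu) uv | inj₂ (inj₂ r) = ⊥-elim (remote-near′ D r Bu (~-sym uv))
    ¬Wr = proj₂ (¬∀⟶∃¬ n W W? ¬all)
  ... | yes cover = record
      { side          = side? A?
      ; left          = a
      ; right         = d
      ; left-side     = side-true A? (inj₂ ab , ad)
      ; right-side    = side-false A? λ { (inj₁ refl , _) → ~⇒¬≁ ab ad
                                       ; (inj₂ db , _) → ~⇒¬≁ db (≁-sym bd) }
      ; left-private  = λ y y∉ → ≁-sym (proj₂ (B y∉))
      ; right-private = λ x x∈ → proj₂ (A x∈)
      ; cross-left    = λ x∈ y∉ xy z z∈ x≢z → [ (λ yb → cross-b⇒universal D (A x∈) (B y∉) xy yb (A z∈) x≢z)
                                             , (λ xc → near-c⇒universal D (A x∈) xc (A z∈) x≢z) ]′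
                                             (cross-adjacent D (A x∈) (B y∉) xy)
      ; cross-right   = λ x∈ y∉ xy z z∉ y≢z → [ (λ yb → near-b⇒universal D (B y∉) yb (B z∉) y≢z)
                                             , (λ xc → cross-c⇒universal D (A x∈) (B y∉) xy xc (B z∉) y≢z) ]′
                                             (cross-adjacent D (A x∈) (B y∉) xy)
      }
    where
    open Distant D
    A? = near? b d
    A : ∀ {v} → side? A? v ≡ true → Near b d v
    A = side-true⁻ A?
    B : ∀ {v} → side? A? v ≡ false → Near c a v
    B {v} eq with cover v
    ... | inj₁ p = contradiction p (side-false⁻ A? eq)
    ... | inj₂ p = p

  Reach : Fin n → Fin n → Set
  Reach a v = (a ≡ v ⊎ a ~ v) ⊎ (∃ λ x → a ~ x × x ~ v) ⊎ (∃ λ x → a ~ x × ∃ λ y → x ~ y × y ~ v)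

  reach? : ∀ a → Decidable (Reach a)
  reach? a v = ((a ≟ v) ⊎-dec (a ~? v)) ⊎-dec (any? (λ x → (a ~? x) ×-dec (x ~? v)) ⊎-dec
               any? (λ x → (a ~? x) ×-dec any? (λ y → (x ~? y) ×-dec (y ~? v))))

  -- Three steps exhaust a component: a walk of four steps from `a` without shortcuts is an induced
  -- P₅.
  reach-closed : ∀ {a u v} → Reach a u → u ~ v → Reach a v
  reach-closed (inj₁ (inj₁ refl)) uv = inj₁ (inj₂ uv)
  reach-closed (inj₁ (inj₂ au)) uv = inj₂ (inj₁ (_ , au , uv))
  reach-closed (inj₂ (inj₁ (x , ax , xu))) uv = inj₂ (inj₂ (x , ax , _ , xu , uv))
  reach-closed {a} {u} {v} (inj₂ (inj₂ (x , ax , y , xy , yu))) uv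
    with ~-or-≁ a v | ~-or-≁ x v | ~-or-≁ y v | ~-or-≁ a u | ~-or-≁ x u | ~-or-≁ a y
  ... | inj₁ av | _ | _ | _ | _ | _ = inj₁ (inj₂ av)
  ... | _ | inj₁ xv | _ | _ | _ | _ = inj₂ (inj₁ (x , ax , xv))
  ... | _ | _ | inj₁ yv | _ | _ | _ = inj₂ (inj₂ (x , ax , y , xy , yv))
  ... | _ | _ | _ | inj₁ au | _ | _ = inj₂ (inj₁ (u , au , uv))
  ... | _ | _ | _ | _ | inj₁ xu | _ = inj₂ (inj₂ (x , ax , u , xu , uv))
  ... | _ | _ | _ | _ | _ | inj₁ ay = inj₂ (inj₂ (y , ay , u , yu , uv))
  ... | inj₂ av | inj₂ xv | inj₂ yv | inj₂ au | inj₂ xu | inj₂ ay =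
    ⊥-elim (noP5 a x y u v ax ay au av xy xu xv yu yv uv)

  no-common⇒split : ∀ {a d} → a ≢ d → a ≁ d → (∀ x → x ~ a → x ~ d → ⊥) → Split G
  no-common⇒split {a} {d} a≢d ad far with reach? a d
  ... | no ¬r = closed⇒split (reach? a) reach-closed (inj₁ (inj₁ refl)) ¬r
  ... | yes (inj₁ (inj₁ a≡d)) = ⊥-elim (a≢d a≡d)
  ... | yes (inj₁ (inj₂ a~d)) = ⊥-elim (~⇒¬≁ a~d ad)
  ... | yes (inj₂ (inj₁ (x , ax , xd))) = ⊥-elim (far x (~-sym ax) xd)
  ... | yes (inj₂ (inj₂ (x , ax , y , xy , yd))) =
    distant⇒split (mkDistant ax xy yd (¬~⇒≁ λ ay → far y (~-sym ay) yd) (¬~⇒≁ λ xd → far x (~-sym ax) xd) ad far)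

  -- Graphs of diameter two without a universal vertex

  module DiameterTwo
    (common : ∀ u v → u ≢ v → u ≁ v → ∃ λ x → u ~ x × v ~ x)
    (nonneighbour : ∀ u → ∃ λ v → u ≢ v × u ≁ v)
    where

    N[_] : Fin n → Subset n
    N[ x ] = tabulate λ v → does ((x ≟ v) ⊎-dec (x ~? v))

    ∈N⁺ : ∀ {x v} → x ≡ v ⊎ x ~ v → v ∈ N[ x ]
    ∈N⁺ {x} {v} p = lookup⇒[]= v N[ x ] (trans (lookup∘tabulate _ v) (dec-true ((x ≟ v) ⊎-dec (x ~? v)) p))

    ∈N⁻ : ∀ {x v} → v ∈ N[ x ] → x ≡ v ⊎ x ~ v
    ∈N⁻ {x} {v} v∈ = side-true⁻ (λ v → (x ≟ v) ⊎-dec (x ~? v)) (trans (≡-sym (lookup∘tabulate _ v)) ([]=⇒lookup v∈))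

    -- N[b] is not properly contained in any N[x].
    Maximal : Fin n → Set
    Maximal b = ∀ x r → b ~ x → x ~ r → b ≁ r → b ≢ r → ∃ λ a → b ~ a × a ≁ x × a ≢ x

    -- Maximality gives `a`, a neighbour of `b` outside N[x]. If `a ~ r`, it closes the cycle with
    -- `x`. If not, a common neighbour `v` of `a` and `r` is forced to see both `b` and `x`, and it
    -- takes the place of `x`.
    find-C4 : ∀ {b r} → Maximal b → b ≢ r → b ≁ r → ∀ x → b ~ x → x ~ r →
              Acc _⊃_ (N[ x ] ∩ N[ b ]) → ∃₂ λ p q → C4 b p r q
    find-C4 {b} {r} max b≢r br x bx xr (acc rec) with max x r bx xr br b≢r
    ... | a , ba , ax , a≢x with ~-or-≁ a r
    ...   | inj₁ ar = a , x , mkC4 ba ar (~-sym xr) (~-sym bx) br ax b≢r a≢x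
    ...   | inj₂ ar with common a r (separated b (~-sym ba) (≁-sym br)) ar
    ...     | v , av , rv with ~-or-≁ v b | ~-or-≁ v x
    ...       | inj₂ vb | inj₂ vx = ⊥-elim (noC5 a b x r v (~-sym ba) ax ar av bx br (≁-sym vb) xr (≁-sym vx) rv)
    ...       | inj₂ vb | inj₁ vx =
      ⊥-elim (~⇒¬≁ (proj₁ (proj₂ (C4-module (mkC4 (~-sym bx) ba av vx (≁-sym ax) (≁-sym vb) (a≢x ∘ ≡-sym) (separated′ r br (~-sym rv))) (~-sym xr)
         (b≢r ∘ ≡-sym) (~⇒≢ rv)))) (≁-sym ar))
    ...       | inj₁ vb | inj₂ vx =
      ⊥-elim (~⇒¬≁ (proj₁ (proj₂ (C4-module (mkC4 bx xr rv vb br (≁-sym vx) b≢r (separated′ a (≁-sym ax) (~-sym av))) (~-sym ba)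
         a≢x (~⇒≢ av)))) ar)
    ...       | inj₁ vb | inj₁ vx with all? (λ p → ((x ~? p) ×-dec (b ~? p)) →-dec ((v ≟ p) ⊎-dec (v ~? p)))
    -- The recursion ends because N[v] ∩ N[b] contains N[x] ∩ N[b] and also `a`, which is not in
    -- N[x].
    ...         | yes sub = find-C4 max b≢r br v (~-sym vb) (~-sym rv) (rec grows)
      where
      v∈ : ∀ {p} → (x ≡ p ⊎ x ~ p) → (b ≡ p ⊎ b ~ p) → v ≡ p ⊎ v ~ p
      v∈ (inj₁ refl) _ = inj₂ vx
      v∈ _ (inj₁ refl) = inj₂ vb
      v∈ {p} (inj₂ xp) (inj₂ bp) = sub p (xp , bp)
      grows : N[ x ] ∩ N[ b ] ⊂ N[ v ] ∩ N[ b ]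
      grows = (λ p∈ → let (p₁ , p₂) = x∈p∩q⁻ N[ x ] N[ b ] p∈ in x∈p∩q⁺ (∈N⁺ (v∈ (∈N⁻ p₁) (∈N⁻ p₂)) , p₂))
            , a , x∈p∩q⁺ (∈N⁺ (inj₂ (~-sym av)) , ∈N⁺ (inj₂ ba))
            , λ a∈ → [ (λ x≡a → a≢x (≡-sym x≡a)) , (λ xa → ~⇒¬≁ xa (≁-sym ax)) ]′ (∈N⁻ (proj₁ (x∈p∩q⁻ N[ x ] N[ b ] a∈)))
    ...         | no ¬sub with ¬∀⟶∃¬ n _ (λ p → ((x ~? p) ×-dec (b ~? p)) →-dec ((v ≟ p) ⊎-dec (v ~? p))) ¬sub
    ...           | p , ¬p = ⊥-elim impossible
      where
      xbp : x ~ p × b ~ p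
      xbp = decidable-stable ((x ~? p) ×-dec (b ~? p)) λ ¬q → ¬p λ q → ⊥-elim (¬q q)
      xp = proj₁ xbp
      bp = proj₂ xbp
      v≢p : v ≢ p
      v≢p v≡p = ¬p λ _ → inj₁ v≡p
      vp : v ≁ p
      vp = ¬~⇒≁ λ v~p → ¬p λ _ → inj₂ v~p
      impossible : ⊥
      impossible with ~-or-≁ p r | ~-or-≁ p a
      ... | inj₁ pr | _ = ~⇒¬≁ (proj₁ (proj₂ (C4-module (mkC4 bp pr rv vb br (≁-sym vp) b≢r (v≢p ∘ ≡-sym)) (~-sym ba)
                            (separated′ x ax (~-sym xp)) (~⇒≢ av)))) ar
      ... | inj₂ pr | inj₂ pa = noBull b v a p r (~-sym vb) ba bp br (~-sym av) vp (~-sym rv) (≁-sym pa) ar pr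
      ... | inj₂ pr | inj₁ pa = ~⇒¬≁ (proj₁ (proj₂ (C4-module (mkC4 xp pa av vx (≁-sym ax) (≁-sym vp) (a≢x ∘ ≡-sym) (v≢p ∘ ≡-sym)) (~-sym xr)
                            (separated′ b (≁-sym br) (~-sym bp)) (~⇒≢ rv)))) (≁-sym ar)

    Paired : Fin n → Set
    Paired b = ∃ λ r → Mate G b r × ∃₂ λ p q → C4 b p r q

    -- A second nonneighbour `u` of `b` sees neither `p` nor `q`. A common neighbour `y` of `b` and
    -- `u` sees the whole cycle, and so does a neighbour `z` of `b` outside N[y], which maximality
    -- provides. Then `y`, `r`, `z`, `b` is a 4-cycle, and `u` sees `y` but not `b`.
    maximal⇒paired : ∀ b → Maximal b → Paired b
    maximal⇒paired b max with nonneighbour b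
    ... | r , b≢r , br with common b r b≢r br
    ...   | x , bx , rx with find-C4 max b≢r br x bx (~-sym rx) (⊃-wellFounded _)
    ...     | p , q , C@(mkC4 bp pr rq qb _ pq _ p≢q) = r , (b≢r , br , unique) , p , q , C
      where
      unique : ∀ u → b ≢ u → b ≁ u → u ≡ r
      unique u b≢u bu = decidable-stable (u ≟ r) λ u≢r →
        let up : u ≁ p
            up = ¬~⇒≁ λ u~p → ~⇒¬≁ (proj₂ (proj₂ (C4-module (rotate C) u~p u≢r (b≢u ∘ ≡-sym)))) (≁-sym bu)
            uq : u ≁ q
            uq = ¬~⇒≁ λ u~q → ~⇒¬≁ (proj₁ (C4-module (rotate (rotate (rotate C))) u~q (b≢u ∘ ≡-sym) u≢r)) (≁-sym bu)
            y , by , uy = common b u b≢u bu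
            yp , yr , yq = C4-module C (~-sym by) (separated u (~-sym uy) (≁-sym up)) (separated u (~-sym uy) (≁-sym uq))
            z , bz , zy , z≢y = max y u by (~-sym uy) bu b≢u
            zp , zr , zq = C4-module C (~-sym bz) (separated′ y zy (~-sym yp)) (separated′ y zy (~-sym yq))
        in ~⇒¬≁ (proj₂ (proj₂ (C4-module (mkC4 yr (~-sym zr) (~-sym bz) by (≁-sym zy) (≁-sym br) (z≢y ∘ ≡-sym) (b≢r ∘ ≡-sym)) uy
             u≢r (b≢u ∘ ≡-sym)))) (≁-sym bu)

    -- Induction on growing closed neighbourhoods. If N[v] is properly contained in N[x], the
    -- pairing of `x` leads to a contradiction, so `v` is maximal after all.
    paired : ∀ v → Acc _⊃_ N[ v ] → Paired v
    paired v (acc rec) with any? (λ x → (v ~? x) ×-dec (any? (λ r → (x ~? r) ×-dec ((v ≁? r) ×-dec ¬? (v ≟ r)))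
                              ×-dec all? (λ a → (v ~? a) →-dec ((x ≟ a) ⊎-dec (x ~? a)))))
    ... | no ¬dominated = maximal⇒paired v maximal
      where
      maximal : Maximal v
      maximal x r vx xr vr v≢r
        with all? (λ a → (v ~? a) →-dec ((x ≟ a) ⊎-dec (x ~? a)))
      ... | yes sub = ⊥-elim (¬dominated (x , vx , (r , xr , vr , v≢r) , sub))
      ... | no ¬sub with ¬∀⟶∃¬ n _ (λ a → (v ~? a) →-dec ((x ≟ a) ⊎-dec (x ~? a))) ¬sub
      ...   | a , ¬a = a , decidable-stable (v ~? a) (λ ¬va → ¬a λ va → ⊥-elim (¬va va))
                     , ≁-sym (¬~⇒≁ λ xa → ¬a λ _ → inj₂ xa) , λ a≡x → ¬a λ _ → inj₁ (≡-sym a≡x)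
    ... | yes (x , vx , (r , xr , vr , v≢r) , sub) with paired x (rec grows)
      where
      x∈ : ∀ {p} → v ≡ p ⊎ v ~ p → x ≡ p ⊎ x ~ p
      x∈ (inj₁ refl) = inj₂ (~-sym vx)
      x∈ {p} (inj₂ vp) = sub p vp
      grows : N[ v ] ⊂ N[ x ]
      grows = (λ p∈ → ∈N⁺ (x∈ (∈N⁻ p∈))) , r , ∈N⁺ (inj₂ xr)
            , λ r∈ → [ v≢r , (λ v~r → ~⇒¬≁ v~r vr) ]′ (∈N⁻ r∈)
    ...   | s , (x≢s , xs , _) , p , q , C@(mkC4 xp ps sq qx _ _ _ _) =
      -- Whether `v` is `p`, `q` or off the cycle, it sees `s`; but N[v] ⊆ N[x], and `x` misses `s`.
      ⊥-elim (vs (proj₁ (proj₂ (C4-module C vx (λ { refl → vs ps }) (λ { refl → vs (~-sym sq) })))))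
      where
      vs : ¬ v ~ s
      vs v~s = [ x≢s , (λ x~s → ~⇒¬≁ x~s xs) ]′ (sub s v~s)

  structure : Structure G
  structure with any? (λ u → all? (λ v → ¬? (u ≟ v) →-dec (u ~? v)))
  ... | yes (u , univ) = universal u univ
  ... | no ¬univ with all? (λ u → all? (λ v → ¬? (u ≟ v) →-dec ((u ≁? v) →-dec any? (λ x → (u ~? x) ×-dec (v ~? x)))))
  ...   | yes common = matched λ v → let r , m , p , _ , C = paired v (⊃-wellFounded _) in r , m , p , C4.ab C
    where
    nonneighbour : ∀ u → ∃ λ v → u ≢ v × u ≁ v
    nonneighbour u with ¬∀⟶∃¬ n _ (λ v → ¬? (u ≟ v) →-dec (u ~? v)) (λ all → ¬univ (u , all))
    ... | v , ¬p = v , (λ u≡v → ¬p λ u≢v → ⊥-elim (u≢v u≡v)) , ¬~⇒≁ λ uv → ¬p λ _ → uv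
    open DiameterTwo common nonneighbour
  ...   | no ¬common with ¬∀⟶∃¬ n _ (λ u → all? (λ v → ¬? (u ≟ v) →-dec ((u ≁? v) →-dec any? (λ x → (u ~? x) ×-dec (v ~? x))))) ¬common
  ...     | a , ¬a with ¬∀⟶∃¬ n _ (λ v → ¬? (a ≟ v) →-dec ((a ≁? v) →-dec any? (λ x → (a ~? x) ×-dec (v ~? x)))) ¬a
  ...       | d , ¬d = split (no-common⇒split
                          (λ a≡d → ¬d λ a≢d → ⊥-elim (a≢d a≡d))
                          (¬~⇒≁ λ a~d → ¬d λ _ ad → ⊥-elim (~⇒¬≁ a~d ad))
                          (λ x xa xd → ¬d λ _ _ → x , ~-sym xa , ~-sym xd))

-- Weights

-- Subsets are handled as Boolean predicates, so that they can be pulled back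
-- along arbitrary maps of vertices.
weight : ∀ {n} → (Fin n → ℕ) → (Fin n → Bool) → ℕ
weight w P = sum λ i → if P i then w i else 0

Covers : ∀ {n} → Graph n → (Fin n → Bool) → Set
Covers G P = ∀ v → P v ≡ true ⊎ ∃ λ u → P u ≡ true × adj G u v ≡ true

infix 4 _⊑_
_⊑_ : ∀ {n} → (Fin n → Bool) → (Fin n → Bool) → Set
P ⊑ Q = ∀ v → P v ≡ true → Q v ≡ true

MinCover : ∀ {n} → Graph n → (Fin n → Bool) → Set
MinCover G P = Covers G P × (∀ Q → Q ⊑ P → Covers G Q → P ⊑ Q)

record Weighted {n} (G : Graph n) : Set where
  field
    total      : ℕ
    total≥1    : total ≥ 1
    w          : Fin n → ℕ
    w≥1        : ∀ v → w v ≥ 1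
    min⇒total  : ∀ P → MinCover G P → weight w P ≡ total
    total⇒min  : ∀ P → weight w P ≡ total → MinCover G P

wsum≡weight : ∀ {n} (w : Fin n → ℕ) (D : Subset n) → wsum w D ≡ weight w (lookup D)
wsum≡weight w []      = refl
wsum≡weight w (b ∷ D) = cong ((if b then w zero else 0) +_) (wsum≡weight (w ∘ suc) D)

Covers⇒Dominating : ∀ {n} (G : Graph n) {P} D → (∀ v → lookup D v ≡ P v) → Covers G P → Dominating G D
Covers⇒Dominating G D D≗P cov v with cov v
... | inj₁ Pv            = inj₁ (lookup⇒[]= v D (trans (D≗P v) Pv))
... | inj₂ (u , Pu , uv) = inj₂ (u , lookup⇒[]= u D (trans (D≗P u) Pu) , uv)

Dominating⇒Covers : ∀ {n} (G : Graph n) {D} → Dominating G D → Covers G (lookup D)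
Dominating⇒Covers G dom v with dom v
... | inj₁ v∈            = inj₁ ([]=⇒lookup v∈)
... | inj₂ (u , u∈ , uv) = inj₂ (u , []=⇒lookup u∈ , uv)

MDS⇒MinCover : ∀ {n} (G : Graph n) {D} → MDS G D → MinCover G (lookup D)
MDS⇒MinCover G {D} (dom , min) = Dominating⇒Covers G dom , λ Q Q⊑ cov v v∈ →
  let Q′ = tabulate Q
      eq = lookup∘tabulate Q
      D⊆Q = min Q′ (λ {x} x∈ → lookup⇒[]= x D (Q⊑ x (trans (≡-sym (eq x)) ([]=⇒lookup x∈)))) (Covers⇒Dominating G Q′ eq cov)
  in trans (≡-sym (eq v)) ([]=⇒lookup (D⊆Q (lookup⇒[]= v D v∈)))

MinCover⇒MDS : ∀ {n} (G : Graph n) {D} → MinCover G (lookup D) → MDS G D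
MinCover⇒MDS G {D} (cov , min) = Covers⇒Dominating G D (λ _ → refl) cov , λ D′ D′⊆ dom {x} x∈ →
  lookup⇒[]= x D′ (min (lookup D′) (λ v v∈ → []=⇒lookup (D′⊆ (lookup⇒[]= v D′ v∈))) (Dominating⇒Covers G dom) x ([]=⇒lookup x∈))

Weighted⇒Equidominating : ∀ {n} (G : Graph n) → Weighted G → Equidominating G
Weighted⇒Equidominating G W = total , total≥1 , w , w≥1 , λ D →
    (λ mds → trans (wsum≡weight w D) (min⇒total (lookup D) (MDS⇒MinCover G mds)))
  , (λ eq → MinCover⇒MDS G (total⇒min (lookup D) (trans (≡-sym (wsum≡weight w D)) eq)))
  where open Weighted W

weight-empty : ∀ {n} (w : Fin n → ℕ) {P} → (∀ i → P i ≡ false) → weight w P ≡ 0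
weight-empty {n} w empty = trans (sum-cong-≗ λ i → cong (λ b → if b then w i else 0) (empty i)) (sum-replicate-zero n)

weight≡0⇒empty : ∀ {n} {w : Fin n → ℕ} {P} → (∀ v → w v ≥ 1) → weight w P ≡ 0 → ∀ i → P i ≡ false
weight≡0⇒empty {suc n} {w} {P} w≥1 eq zero with P zero | m+n≡0⇒m≡0 (if P zero then w zero else 0) eq
... | false | _ = refl
... | true  | w≡0 with w zero | w≥1 zero
weight≡0⇒empty {suc n} w≥1 eq zero | true | () | suc _ | _
weight≡0⇒empty {suc n} {w} {P} w≥1 eq (suc i) =
  weight≡0⇒empty {w = w ∘ suc} (w≥1 ∘ suc) (m+n≡0⇒n≡0 (if P zero then w zero else 0) eq) i

weight≤sum : ∀ {n} (w : Fin n → ℕ) P → weight w P ≤ sum w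
weight≤sum {zero}  w P = z≤n
weight≤sum {suc n} w P = +-mono-≤ (if≤ (P zero)) (weight≤sum (w ∘ suc) (P ∘ suc))
  where
  if≤ : ∀ b → (if b then w zero else 0) ≤ w zero
  if≤ true  = ≤-refl
  if≤ false = z≤n

weight≢0⇒inhabited : ∀ {n k} {w : Fin n → ℕ} {P} → weight w P ≡ suc k → ∃ λ i → P i ≡ true
weight≢0⇒inhabited {w = w} {P} eq with any? (λ i → P i Bool.≟ true)
... | yes found = found
... | no none   = contradiction (trans (≡-sym eq) (weight-empty w λ i → Bool.¬-not λ Pi → none (i , Pi))) λ ()

weight-remove : ∀ {n} (w : Fin (suc n) → ℕ) P u →
  weight w P ≡ (if P u then w u else 0) + weight (w ∘ punchIn u) (P ∘ punchIn u)
weight-remove w P u = sum-remove {i = u} (λ i → if P i then w i else 0)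

data PunchView {n} (u : Fin (suc n)) : Fin (suc n) → Set where
  here  : PunchView u u
  there : ∀ j → PunchView u (punchIn u j)

punchView : ∀ {n} (u v : Fin (suc n)) → PunchView u v
punchView u v with u ≟ v
... | yes refl = here
... | no u≢v   = subst (PunchView u) (punchIn-punchOut u≢v) (there (punchOut u≢v))

-- The minimal dominating sets of `G` are the singleton of `u` and those of `H`. The size makes `H`
-- nonempty, so a set dominating `H` has a member, which dominates `u`; in an empty `H` the empty
-- set would be dominating.
module UniversalVertex {m} (G : Graph (suc (suc m))) (u : Fin (suc (suc m))) (univ : Universal G u) where

  H : Graph (suc m)
  H = induced G (punchIn u)

  covers-delete : ∀ {P} → P u ≡ false → Covers G P → Covers H (P ∘ punchIn u)
  covers-delete ¬Pu cov j with cov (punchIn u j)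
  ... | inj₁ Pj = inj₁ Pj
  ... | inj₂ (x , Px , xj) with punchView u x
  ...   | here    = ⊥-elim (true≢false Px ¬Pu)
  ...   | there i = inj₂ (i , Px , xj)

  covers-insert : ∀ {P} → Covers H (P ∘ punchIn u) → Covers G P
  covers-insert {P} cov v with punchView u v
  covers-insert {P} cov .(punchIn u j) | there j with cov j
  ... | inj₁ Pj            = inj₁ Pj
  ... | inj₂ (i , Pi , ij) = inj₂ (punchIn u i , Pi , ij)
  covers-insert {P} cov .u | here with cov zero
  ... | inj₁ P0           = inj₂ (punchIn u zero , P0 , trans (sym G _ u) (univ _ (punchInᵢ≢i u zero ∘ ≡-sym)))
  ... | inj₂ (i , Pi , _) = inj₂ (punchIn u i , Pi , trans (sym G _ u) (univ _ (punchInᵢ≢i u i ∘ ≡-sym)))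

  delete-min : ∀ {P} → P u ≡ false → MinCover G P → MinCover H (P ∘ punchIn u)
  delete-min {P} ¬Pu (cov , min) = covers-delete ¬Pu cov , λ Q Q⊑P covQ j Pj →
    let Q⁺ = insertAt Q u false
        eq = insertAt-punchIn Q u false
        Q⁺⊑P : Q⁺ ⊑ P
        Q⁺⊑P v = λ { Qv → case-view Q Q⊑P v (punchView u v) Qv }
        covQ⁺ : Covers H (Q⁺ ∘ punchIn u)
        covQ⁺ i = Sum.map (trans (eq i)) (λ (x , Qx , xi) → x , trans (eq x) Qx , xi) (covQ i)
    in trans (≡-sym (eq j)) (min Q⁺ Q⁺⊑P (covers-insert covQ⁺) (punchIn u j) Pj)
    where
    case-view : ∀ Q → Q ⊑ (P ∘ punchIn u) → ∀ v → PunchView u v → insertAt Q u false v ≡ true → P v ≡ true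
    case-view Q Q⊑P .u here Qu = ⊥-elim (true≢false Qu (insertAt-lookup Q u false))
    case-view Q Q⊑P .(punchIn u j) (there j) Qj = Q⊑P j (trans (≡-sym (insertAt-punchIn Q u false j)) Qj)

  insert-min : ∀ {P} → P u ≡ false → MinCover H (P ∘ punchIn u) → MinCover G P
  insert-min {P} ¬Pu (cov , min) = covers-insert cov , λ Q Q⊑P covQ v → lemma Q Q⊑P covQ (punchView u v)
    where
    lemma : ∀ Q → Q ⊑ P → Covers G Q → ∀ {v} → PunchView u v → P v ≡ true → Q v ≡ true
    lemma Q Q⊑P covQ here Pu = ⊥-elim (true≢false Pu ¬Pu)
    lemma Q Q⊑P covQ (there j) Pj =
      min (Q ∘ punchIn u) (Q⊑P ∘ punchIn u) (covers-delete ¬Qu covQ) j Pj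
      where
      ¬Qu : Q u ≡ false
      ¬Qu = Bool.¬-not λ Qu → true≢false (Q⊑P u Qu) ¬Pu

  min-with-u : ∀ {P} → P u ≡ true → MinCover G P → ∀ j → P (punchIn u j) ≡ false
  min-with-u {P} Pu (_ , min) j = Bool.¬-not λ Pj → only-u (min single single⊑P single-covers (punchIn u j) Pj)
    where
    single : Fin (suc (suc m)) → Bool
    single v = does (u ≟ v)
    single⊑P : single ⊑ P
    single⊑P v eq with does⁻ (u ≟ v) eq
    ... | refl = Pu
    single-covers : Covers G single
    single-covers v with u ≟ v
    ... | yes refl = inj₁ refl
    ... | no u≢v   = inj₂ (u , dec-true (u ≟ u) refl , univ v u≢v)
    only-u : single (punchIn u j) ≡ true → ⊥
    only-u eq = punchInᵢ≢i u j (≡-sym (does⁻ (u ≟ punchIn u j) eq))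

  just-u-min : ∀ {P} → P u ≡ true → (∀ j → P (punchIn u j) ≡ false) → MinCover G P
  just-u-min {P} Pu empty = covers , λ Q Q⊑P covQ v → is-u Q (Q-has-u Q Q⊑P covQ) (punchView u v)
    where
    covers : Covers G P
    covers v with u ≟ v
    ... | yes refl = inj₁ Pu
    ... | no u≢v   = inj₂ (u , Pu , univ v u≢v)
    Q-has-u : ∀ Q → Q ⊑ P → Covers G Q → Q u ≡ true
    Q-has-u Q Q⊑P covQ with covQ u
    ... | inj₁ Qu = Qu
    ... | inj₂ (x , Qx , _) with punchView u x
    ...   | here    = Qx
    ...   | there j = ⊥-elim (true≢false (Q⊑P _ Qx) (empty j))
    is-u : ∀ Q → Q u ≡ true → ∀ {v} → PunchView u v → P v ≡ true → Q v ≡ true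
    is-u Q Qu here      _  = Qu
    is-u Q Qu (there j) Pj = ⊥-elim (true≢false Pj (empty j))

  add-weighted : Weighted H → Weighted G
  add-weighted W = record
    { total     = total
    ; total≥1   = total≥1
    ; w         = w⁺
    ; w≥1       = λ v → w⁺≥1 (punchView u v)
    ; min⇒total = min⇒
    ; total⇒min = ⇒min
    }
    where
    open Weighted W
    w⁺ = insertAt w u total
    w⁺≥1 : ∀ {v} → PunchView u v → w⁺ v ≥ 1
    w⁺≥1 here      = subst (_≥ 1) (≡-sym (insertAt-lookup w u total)) total≥1
    w⁺≥1 (there j) = subst (_≥ 1) (≡-sym (insertAt-punchIn w u total j)) (w≥1 j)

    weight⁺ : ∀ P → weight w⁺ P ≡ (if P u then total else 0) + weight w (P ∘ punchIn u)
    weight⁺ P = trans (weight-remove w⁺ P u)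
      (cong₂ _+_ (cong (λ x → if P u then x else 0) (insertAt-lookup w u total))
                 (sum-cong-≗ λ j → cong (λ x → if P (punchIn u j) then x else 0) (insertAt-punchIn w u total j)))

    weight⁺-true : ∀ P → P u ≡ true → weight w⁺ P ≡ total + weight w (P ∘ punchIn u)
    weight⁺-true P Pu = trans (weight⁺ P) (cong (λ b → (if b then total else 0) + weight w (P ∘ punchIn u)) Pu)

    weight⁺-false : ∀ P → P u ≡ false → weight w⁺ P ≡ weight w (P ∘ punchIn u)
    weight⁺-false P ¬Pu = trans (weight⁺ P) (cong (λ b → (if b then total else 0) + weight w (P ∘ punchIn u)) ¬Pu)

    min⇒ : ∀ P → MinCover G P → weight w⁺ P ≡ total
    min⇒ P min with bool-cases (P u)
    ... | inj₁ Pu  = trans (weight⁺-true P Pu) (trans (cong (total +_) (weight-empty w (min-with-u Pu min))) (+-identityʳ total))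
    ... | inj₂ ¬Pu = trans (weight⁺-false P ¬Pu) (min⇒total _ (delete-min ¬Pu min))

    ⇒min : ∀ P → weight w⁺ P ≡ total → MinCover G P
    ⇒min P eq with bool-cases (P u)
    -- The vertex `u` uses up the whole target, and positive weights leave room for no further
    -- member.
    ... | inj₁ Pu  = just-u-min Pu (weight≡0⇒empty w≥1 (+-cancelˡ-≡ total _ 0 (trans (≡-sym (weight⁺-true P Pu)) (trans eq (≡-sym (+-identityʳ total))))))
    ... | inj₂ ¬Pu = insert-min ¬Pu (total⇒min _ (trans (≡-sym (weight⁺-false P ¬Pu)) eq))

-- Weights: the two sides of a split

record Partition {n} (side : Fin n → Bool) : Set where
  field
    a b        : ℕ
    inl        : Fin a → Fin n
    inr        : Fin b → Fin n
    locate     : Fin n → Fin a ⊎ Fin b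
    inl-side   : ∀ i → side (inl i) ≡ true
    inr-side   : ∀ j → side (inr j) ≡ false
    locate-inl : ∀ i → locate (inl i) ≡ inj₁ i
    locate-inr : ∀ j → locate (inr j) ≡ inj₂ j
    recover    : ∀ v → [ inl , inr ]′ (locate v) ≡ v
    size       : n ≡ a + b
    sum-split  : ∀ t → sum t ≡ sum (t ∘ inl) + sum (t ∘ inr)

  data Located : Fin n → Set where
    left  : ∀ i → Located (inl i)
    right : ∀ j → Located (inr j)

  located : ∀ v → Located v
  located v with locate v | recover v
  ... | inj₁ i | refl = left i
  ... | inj₂ j | refl = right j

  inl-injective : Injective _≡_ _≡_ inl
  inl-injective {i} {j} eq with trans (≡-sym (locate-inl i)) (trans (cong locate eq) (locate-inl j))
  ... | refl = refl

  inr-injective : Injective _≡_ _≡_ inr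
  inr-injective {i} {j} eq with trans (≡-sym (locate-inr i)) (trans (cong locate eq) (locate-inr j))
  ... | refl = refl

partition : ∀ {n} (side : Fin n → Bool) → Partition side
partition {zero} side = record
  { a = 0 ; b = 0 ; inl = λ () ; inr = λ () ; locate = λ () ; inl-side = λ () ; inr-side = λ ()
  ; locate-inl = λ () ; locate-inr = λ () ; recover = λ () ; size = refl ; sum-split = λ _ → refl }
partition {suc n} side with side zero in eq
... | true = record
  { a          = suc a
  ; b          = b
  ; inl        = lift 1 inl
  ; inr        = suc ∘ inr
  ; locate     = λ { zero → inj₁ zero ; (suc v) → Sum.map₁ suc (locate v) }
  ; inl-side   = λ { zero → eq ; (suc i) → inl-side i }
  ; inr-side   = inr-side
  ; locate-inl = λ { zero → refl ; (suc i) → cong (Sum.map₁ suc) (locate-inl i) }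
  ; locate-inr = λ j → cong (Sum.map₁ suc) (locate-inr j)
  ; recover    = λ { zero → refl ; (suc v) → recover′ v }
  ; size       = cong suc size
  ; sum-split  = λ t → trans (cong (t zero +_) (sum-split (t ∘ suc))) (≡-sym (+-assoc (t zero) _ _))
  }
  where
  open Partition (partition (side ∘ suc))
  recover′ : ∀ v → [ lift 1 inl , suc ∘ inr ]′ (Sum.map₁ suc (locate v)) ≡ suc v
  recover′ v with locate v | recover v
  ... | inj₁ i | refl = refl
  ... | inj₂ j | refl = refl
... | false = record
  { a          = a
  ; b          = suc b
  ; inl        = suc ∘ inl
  ; inr        = lift 1 inr
  ; locate     = λ { zero → inj₂ zero ; (suc v) → Sum.map₂ suc (locate v) }
  ; inl-side   = inl-side
  ; inr-side   = λ { zero → eq ; (suc j) → inr-side j }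
  ; locate-inl = λ i → cong (Sum.map₂ suc) (locate-inl i)
  ; locate-inr = λ { zero → refl ; (suc j) → cong (Sum.map₂ suc) (locate-inr j) }
  ; recover    = λ { zero → refl ; (suc v) → recover′ v }
  ; size       = trans (cong suc size) (≡-sym (+-suc a b))
  ; sum-split  = λ t → trans (cong (t zero +_) (sum-split (t ∘ suc)))
                             (x+[y+z]≡y+[x+z] (t zero) (sum (t ∘ suc ∘ inl)) _)
  }
  where
  open Partition (partition (side ∘ suc))
  x+[y+z]≡y+[x+z] : ∀ x y z → x + (y + z) ≡ y + (x + z)
  x+[y+z]≡y+[x+z] x y z = trans (≡-sym (+-assoc x y z)) (trans (cong (_+ z) (+-comm x y)) (+-assoc y x z))
  recover′ : ∀ v → [ suc ∘ inl , lift 1 inr ]′ (Sum.map₂ suc (locate v)) ≡ suc v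
  recover′ v with locate v | recover v
  ... | inj₁ i | refl = refl
  ... | inj₂ j | refl = refl

digits-unique : ∀ {m x y p q} → x < suc m → y < suc m → x + suc m * p ≡ y + suc m * q → x ≡ y × p ≡ q
digits-unique {m} {x} {y} {p} {q} x< y< eq = x≡y , *-cancelˡ-≡ p q (suc m) (+-cancelˡ-≡ y _ _ (trans (cong (_+ suc m * p) (≡-sym x≡y)) eq))
  where
  last-digit : ∀ z r → z < suc m → (z + suc m * r) % suc m ≡ z
  last-digit z r z< = trans (cong (λ s → (z + s) % suc m) (*-comm (suc m) r)) (trans ([m+kn]%n≡m%n z r (suc m)) (m<n⇒m%n≡m z<))
  x≡y : x ≡ y
  x≡y = trans (≡-sym (last-digit x p x<)) (trans (cong (_% suc m) eq) (last-digit y q y<))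

-- A set dominates `G` exactly if its traces dominate both sides. Minimality then splits as well, so
-- the minimal dominating sets of `G` are the unions of one from each side.
module SplitWeight {n} (G : Graph n) (S : Split G) (Π : Partition (Split.side S)) where
  open Split S hiding (left; right)
  open Split S using () renaming (left to l₀; right to r₀)
  open Partition Π

  G₁ : Graph a
  G₁ = induced G inl

  G₂ : Graph b
  G₂ = induced G inr

  -- Because of the anchor x₀, a dominating set meets this side; and the vertices it
  -- dominates from the other side are universal in this one.
  dominated-within : ∀ {s P} x₀ → side x₀ ≡ s →
    (∀ y → side y ≢ s → adj G y x₀ ≡ false) →
    (∀ v y → side v ≡ s → side y ≢ s → adj G y v ≡ true → ∀ z → side z ≡ s → v ≢ z → adj G z v ≡ true) →
    Covers G P → ∀ v → side v ≡ s → P v ≡ true ⊎ ∃ λ u → side u ≡ s × P u ≡ true × adj G u v ≡ true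
  dominated-within {s} {P} x₀ x₀∈ private-x₀ cross cov v v∈ with cov v
  ... | inj₁ Pv = inj₁ Pv
  ... | inj₂ (u , Pu , uv) with side u Bool.≟ s
  ...   | yes u∈ = inj₂ (u , u∈ , Pu , uv)
  ...   | no u∉ with met
    where
    met : ∃ λ z → side z ≡ s × P z ≡ true
    met with cov x₀
    ... | inj₁ Px₀ = x₀ , x₀∈ , Px₀
    ... | inj₂ (z , Pz , zx₀) with side z Bool.≟ s
    ...   | yes z∈ = z , z∈ , Pz
    ...   | no z∉  = ⊥-elim (true≢false zx₀ (private-x₀ z z∉))
  ...     | z , z∈ , Pz with v ≟ z
  ...       | yes refl = inj₁ Pz
  ...       | no v≢z   = inj₂ (z , z∈ , Pz , cross v u v∈ u∉ uv z z∈ v≢z)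

  covers-left : ∀ {P} → Covers G P → Covers G₁ (P ∘ inl)
  covers-left {P} cov i
    with dominated-within l₀ left-side (λ y y∉ → trans (sym G y l₀) (left-private y (Bool.¬-not y∉)))
           (λ v y v∈ y∉ yv z z∈ v≢z → trans (sym G z v) (cross-left v∈ (Bool.¬-not y∉) (trans (sym G v y) yv) z z∈ v≢z))
           cov (inl i) (inl-side i)
  ... | inj₁ Pi = inj₁ Pi
  ... | inj₂ (u , u∈ , Pu , ui) with located u
  ...   | left k  = inj₂ (k , Pu , ui)
  ...   | right k = ⊥-elim (true≢false u∈ (inr-side k))

  covers-right : ∀ {P} → Covers G P → Covers G₂ (P ∘ inr)
  covers-right {P} cov j
    with dominated-within r₀ right-side (λ y y∉ → right-private y (Bool.¬-not y∉))
           (λ v y v∈ y∉ yv z z∈ v≢z → trans (sym G z v) (cross-right (Bool.¬-not y∉) v∈ yv z z∈ v≢z))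
           cov (inr j) (inr-side j)
  ... | inj₁ Pj = inj₁ Pj
  ... | inj₂ (u , u∈ , Pu , uj) with located u
  ...   | left k  = ⊥-elim (true≢false (inl-side k) u∈)
  ...   | right k = inj₂ (k , Pu , uj)

  covers-both : ∀ {P} → Covers G₁ (P ∘ inl) → Covers G₂ (P ∘ inr) → Covers G P
  covers-both cov₁ cov₂ v with located v
  ... | left i  = Sum.map id (λ (k , Pk , ki) → inl k , Pk , ki) (cov₁ i)
  ... | right j = Sum.map id (λ (k , Pk , kj) → inr k , Pk , kj) (cov₂ j)

  glue : (Fin a → Bool) → (Fin b → Bool) → Fin n → Bool
  glue P Q v = [ P , Q ]′ (locate v)

  glue-inl : ∀ P Q i → glue P Q (inl i) ≡ P i
  glue-inl P Q i = cong [ P , Q ]′ (locate-inl i)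

  glue-inr : ∀ P Q j → glue P Q (inr j) ≡ Q j
  glue-inr P Q j = cong [ P , Q ]′ (locate-inr j)

  covers-resp : ∀ {k} (H : Graph k) {P Q} → (∀ v → P v ≡ Q v) → Covers H Q → Covers H P
  covers-resp H P≗Q cov v = Sum.map (trans (P≗Q v)) (λ (u , Qu , uv) → u , trans (P≗Q u) Qu , uv) (cov v)

  -- A smaller dominating set of the left side, glued to the part of `P` on the right, would be a
  -- smaller dominating set of `G`.
  min-left : ∀ {P} → MinCover G P → MinCover G₁ (P ∘ inl)
  min-left {P} (cov , min) = covers-left cov , λ Q Q⊑ covQ i Pi →
    let R = glue Q (P ∘ inr)
        R⊑P : R ⊑ P
        R⊑P v Rv = case-left Q Q⊑ (located v) Rv
        covR = covers-both {R} (covers-resp G₁ (glue-inl Q _) covQ) (covers-resp G₂ (glue-inr Q _) (covers-right cov))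
    in trans (≡-sym (glue-inl Q _ i)) (min R R⊑P covR (inl i) Pi)
    where
    case-left : ∀ Q → Q ⊑ P ∘ inl → ∀ {v} → Located v → glue Q (P ∘ inr) v ≡ true → P v ≡ true
    case-left Q Q⊑ (left i)  Ri = Q⊑ i (trans (≡-sym (glue-inl Q _ i)) Ri)
    case-left Q Q⊑ (right j) Rj = trans (≡-sym (glue-inr Q _ j)) Rj

  min-right : ∀ {P} → MinCover G P → MinCover G₂ (P ∘ inr)
  min-right {P} (cov , min) = covers-right cov , λ Q Q⊑ covQ j Pj →
    let R = glue (P ∘ inl) Q
        R⊑P : R ⊑ P
        R⊑P v Rv = case-right Q Q⊑ (located v) Rv
        covR = covers-both {R} (covers-resp G₁ (glue-inl _ Q) (covers-left cov)) (covers-resp G₂ (glue-inr _ Q) covQ)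
    in trans (≡-sym (glue-inr _ Q j)) (min R R⊑P covR (inr j) Pj)
    where
    case-right : ∀ Q → Q ⊑ P ∘ inr → ∀ {v} → Located v → glue (P ∘ inl) Q v ≡ true → P v ≡ true
    case-right Q Q⊑ (left i)  Ri = trans (≡-sym (glue-inl _ Q i)) Ri
    case-right Q Q⊑ (right j) Rj = Q⊑ j (trans (≡-sym (glue-inr _ Q j)) Rj)

  min-both : ∀ {P} → MinCover G₁ (P ∘ inl) → MinCover G₂ (P ∘ inr) → MinCover G P
  min-both {P} (cov₁ , min₁) (cov₂ , min₂) = covers-both cov₁ cov₂ , λ Q Q⊑P covQ v → lemma Q Q⊑P covQ (located v)
    where
    lemma : ∀ Q → Q ⊑ P → Covers G Q → ∀ {v} → Located v → P v ≡ true → Q v ≡ true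
    lemma Q Q⊑P covQ (left i)  = min₁ (Q ∘ inl) (Q⊑P ∘ inl) (covers-left covQ) i
    lemma Q Q⊑P covQ (right j) = min₂ (Q ∘ inr) (Q⊑P ∘ inr) (covers-right covQ) j

  join-weighted : Weighted G₁ → Weighted G₂ → Weighted G
  join-weighted W₁ W₂ = record
    { total     = t₁ + M * t₂
    ; total≥1   = ≤-trans t₁≥1 (m≤m+n t₁ _)
    ; w         = w
    ; w≥1       = λ v → w≥1 (locate v)
    ; min⇒total = λ P min → trans (weight-w P) (cong₂ (λ x y → x + M * y) (min₁⇒ _ (min-left min)) (min₂⇒ _ (min-right min)))
    ; total⇒min = λ P eq →
        let eq₁ , eq₂ = digits-unique (s≤s (≤-trans (weight≤sum w₁ (P ∘ inl)) (m≤m+n (sum w₁) t₁)))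
                          (s≤s (m≤n+m t₁ (sum w₁))) (trans (≡-sym (weight-w P)) eq)
        in min-both (⇒min₁ _ eq₁) (⇒min₂ _ eq₂)
    }
    where
    open Weighted W₁ renaming (total to t₁; total≥1 to t₁≥1; w to w₁; w≥1 to w₁≥1; min⇒total to min₁⇒; total⇒min to ⇒min₁)
    open Weighted W₂ renaming (total to t₂; total≥1 to t₂≥1; w to w₂; w≥1 to w₂≥1; min⇒total to min₂⇒; total⇒min to ⇒min₂)
    -- The base exceeds the weight of every set on the left, minimal or not, as well as the target
    -- `t₁`. Hence the low digit of any weight is the left weight, without carry.
    M = suc (sum w₁ + t₁)
    w : Fin n → ℕ
    w v = [ w₁ , (λ j → M * w₂ j) ]′ (locate v)
    w≥1 : ∀ x → [ w₁ , (λ j → M * w₂ j) ]′ x ≥ 1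
    w≥1 (inj₁ i) = w₁≥1 i
    w≥1 (inj₂ j) = *-mono-≤ {1} {M} (s≤s z≤n) (w₂≥1 j)
    if-* : ∀ c x → (if c then M * x else 0) ≡ M * (if c then x else 0)
    if-* true  x = refl
    if-* false x = ≡-sym (trans (*-comm M 0) refl)
    weight-w : ∀ P → weight w P ≡ weight w₁ (P ∘ inl) + M * weight w₂ (P ∘ inr)
    weight-w P = trans (sum-split _) (cong₂ _+_
      (sum-cong-≗ λ i → cong (λ x → if P (inl i) then [ w₁ , (λ j → M * w₂ j) ]′ x else 0) (locate-inl i))
      (trans (sum-cong-≗ λ j → trans (cong (λ x → if P (inr j) then [ w₁ , (λ j → M * w₂ j) ]′ x else 0) (locate-inr j)) (if-* (P (inr j)) (w₂ j)))
             (≡-sym (*-distribˡ-sum M (λ j → if P (inr j) then w₂ j else 0)))))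

-- Weights: every vertex has exactly one nonneighbour

count : ∀ {n} → (Fin n → Bool) → ℕ
count = weight (λ _ → 1)

count-remove : ∀ {n} (P : Fin (suc n) → Bool) {u} → P u ≡ true → count P ≡ suc (count (P ∘ punchIn u))
count-remove P {u} Pu = trans (weight-remove _ P u) (cong (λ b → (if b then 1 else 0) + count (P ∘ punchIn u)) Pu)

count≡1⇒unique : ∀ {n} {P : Fin n → Bool} → count P ≡ 1 → ∃ λ u → P u ≡ true × ∀ x → P x ≡ true → x ≡ u
count≡1⇒unique {suc n} {P} eq with weight≢0⇒inhabited {w = λ _ → 1} {P} eq
... | u , Pu = u , Pu , λ x → only (punchView u x)
  where
  empty = weight≡0⇒empty {w = λ _ → 1} {P ∘ punchIn u} (λ _ → ≤-refl) (cong ℕ.pred (trans (≡-sym (count-remove P Pu)) eq))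
  only : ∀ {x} → PunchView u x → P x ≡ true → x ≡ u
  only here      _  = refl
  only (there j) Pj = ⊥-elim (true≢false Pj (empty j))

unique⇒count≡1 : ∀ {n} {P : Fin n → Bool} u → P u ≡ true → (∀ x → P x ≡ true → x ≡ u) → count P ≡ 1
unique⇒count≡1 {suc n} {P} u Pu only = trans (count-remove P Pu)
  (cong suc (weight-empty _ λ j → Bool.¬-not λ Pj → punchInᵢ≢i u j (only _ Pj)))

IsPair : ∀ {n} → (Fin n → Bool) → Fin n → Fin n → Set
IsPair P u v = u ≢ v × P u ≡ true × P v ≡ true × (∀ x → P x ≡ true → x ≡ u ⊎ x ≡ v)

count≡2⇒pair : ∀ {n} {P : Fin n → Bool} → count P ≡ 2 → ∃₂ (IsPair P)
count≡2⇒pair {suc n} {P} eq with weight≢0⇒inhabited {w = λ _ → 1} {P} eq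
... | u , Pu with count≡1⇒unique {P = P ∘ punchIn u} (cong ℕ.pred (trans (≡-sym (count-remove P Pu)) eq))
...   | j , Pj , only = u , punchIn u j , (punchInᵢ≢i u j ∘ ≡-sym) , Pu , Pj , λ x → lemma (punchView u x)
  where
  lemma : ∀ {x} → PunchView u x → P x ≡ true → x ≡ u ⊎ x ≡ punchIn u j
  lemma here      _  = inj₁ refl
  lemma (there k) Pk = inj₂ (cong (punchIn u) (only k Pk))

pair⇒count≡2 : ∀ {n} {P : Fin n → Bool} {u v} → IsPair P u v → count P ≡ 2
pair⇒count≡2 {suc n} {P} {u} {v} (u≢v , Pu , Pv , only) with punchView u v
... | here    = contradiction refl u≢v
... | there j = trans (count-remove P Pu) (cong suc (unique⇒count≡1 j Pv λ i Pi →
  [ (λ eq → ⊥-elim (punchInᵢ≢i u i eq)) , punchIn-injective u i j ]′ (only _ Pi)))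

-- The minimal dominating sets are exactly the two-element sets. A vertex outside such a set misses
-- only its mate, so it sees a member; a single vertex leaves its own mate undominated. The vertex
-- `v₀` rules out the empty graph, where the empty set dominates.
module MatchedWeight {n} (G : Graph n) (v₀ : Fin n) (mate : ∀ v → ∃ (Mate G v)) where

  pair-covers : ∀ {P u v} → u ≢ v → P u ≡ true → P v ≡ true → Covers G P
  pair-covers {P} {u} {v} u≢v Pu Pv x with x ≟ u | x ≟ v | bool-cases (adj G u x) | bool-cases (adj G v x)
  ... | yes refl | _ | _ | _ = inj₁ Pu
  ... | _ | yes refl | _ | _ = inj₁ Pv
  ... | _ | _ | inj₁ ux | _ = inj₂ (u , Pu , ux)
  ... | _ | _ | _ | inj₁ vx = inj₂ (v , Pv , vx)
  ... | no x≢u | no x≢v | inj₂ ux | inj₂ vx with mate x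
  ...   | r , _ , _ , only = contradiction
    (trans (only u x≢u (trans (sym G x u) ux)) (≡-sym (only v x≢v (trans (sym G x v) vx)))) u≢v

  singleton-uncovered : ∀ {Q} u → (∀ x → Q x ≡ true → x ≡ u) → ¬ Covers G Q
  singleton-uncovered u only cov with mate u
  ... | r , u≢r , ur , _ with cov r
  ...   | inj₁ Qr = u≢r (≡-sym (only r Qr))
  ...   | inj₂ (x , Qx , xr) with only x Qx
  ...     | refl = true≢false xr ur

  pair⇒min : ∀ {P u v} → IsPair P u v → MinCover G P
  pair⇒min {P} {u} {v} (u≢v , Pu , Pv , only) = pair-covers u≢v Pu Pv , minimal
    where
    minimal : ∀ Q → Q ⊑ P → Covers G Q → P ⊑ Q
    minimal Q Q⊑P cov x Px with bool-cases (Q x)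
    ... | inj₁ Qx = Qx
    ... | inj₂ ¬Qx with only x Px
    ...   | inj₁ refl = ⊥-elim (singleton-uncovered v (λ y Qy →
      [ (λ { refl → ⊥-elim (true≢false Qy ¬Qx) }) , id ]′ (only y (Q⊑P y Qy))) cov)
    ...   | inj₂ refl = ⊥-elim (singleton-uncovered u (λ y Qy →
      [ id , (λ { refl → ⊥-elim (true≢false Qy ¬Qx) }) ]′ (only y (Q⊑P y Qy))) cov)

  two-elements : ∀ {P} → Covers G P → ∃₂ λ u v → u ≢ v × P u ≡ true × P v ≡ true
  two-elements {P} cov = u , proj₁ second , proj₂ second .proj₁ , Pu , proj₂ second .proj₂
    where
    first : ∃ λ u → P u ≡ true
    first = [ (λ Pv → v₀ , Pv) , (λ (u , Pu , _) → u , Pu) ]′ (cov v₀)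
    u = proj₁ first
    Pu = proj₂ first
    second : ∃ λ v → u ≢ v × P v ≡ true
    second with any? (λ v → ¬? (u ≟ v) ×-dec (P v Bool.≟ true))
    ... | yes found = found
    ... | no none = ⊥-elim (singleton-uncovered u only cov)
      where
      only : ∀ x → P x ≡ true → x ≡ u
      only x Px with u ≟ x
      ... | yes u≡x = ≡-sym u≡x
      ... | no u≢x  = ⊥-elim (none (x , u≢x , Px))

  min⇒pair : ∀ {P} → MinCover G P → ∃₂ (IsPair P)
  min⇒pair {P} (cov , min) with two-elements cov
  ... | u , v , u≢v , Pu , Pv = u , v , u≢v , Pu , Pv , λ x Px → R⁻ x (min R R⊑P (pair-covers u≢v (R⁺ u (inj₁ refl)) (R⁺ v (inj₂ refl))) x Px)
    where
    R? : ∀ x → Dec (x ≡ u ⊎ x ≡ v)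
    R? x = (x ≟ u) ⊎-dec (x ≟ v)
    R : Fin n → Bool
    R x = does (R? x)
    R⁺ : ∀ x → x ≡ u ⊎ x ≡ v → R x ≡ true
    R⁺ x = dec-true (R? x)
    R⁻ : ∀ x → R x ≡ true → x ≡ u ⊎ x ≡ v
    R⁻ x = does⁻ (R? x)
    R⊑P : R ⊑ P
    R⊑P x Rx = [ (λ { refl → Pu }) , (λ { refl → Pv }) ]′ (R⁻ x Rx)

  weighted : Weighted G
  weighted = record
    { total     = 2
    ; total≥1   = s≤s z≤n
    ; w         = λ _ → 1
    ; w≥1       = λ _ → ≤-refl
    ; min⇒total = λ P min → pair⇒count≡2 (proj₂ (proj₂ (min⇒pair min)))
    ; total⇒min = λ P eq → pair⇒min (proj₂ (proj₂ (count≡2⇒pair eq)))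
    }

single-weighted : (G : Graph 1) → Weighted G
single-weighted G = record
  { total     = 1
  ; total≥1   = ≤-refl
  ; w         = λ _ → 1
  ; w≥1       = λ _ → ≤-refl
  ; min⇒total = λ P (cov , _) → unique⇒count≡1 {P = P} zero (covered cov) λ x _ → only x
  ; total⇒min = λ P eq → let u , Pu , _ = count≡1⇒unique {P = P} eq in
      (λ { zero → inj₁ (P0 P u Pu) }) , λ Q _ cov → λ { zero _ → covered cov }
  }
  where
  only : ∀ (x : Fin 1) → x ≡ zero
  only zero = refl
  P0 : ∀ (P : Fin 1 → Bool) u → P u ≡ true → P zero ≡ true
  P0 P zero Pu = Pu
  covered : ∀ {P} → Covers G P → P zero ≡ true
  covered cov with cov zero
  ... | inj₁ P0 = P0
  ... | inj₂ (zero , P0 , _) = P0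

-- Assembling the weights

free-induced : ∀ {n m} (G : Graph n) (f : Fin m → Fin n) → Injective _≡_ _≡_ f → Free G → Free (induced G f)
free-induced G f f-inj free k (g , g-inj , agree) = free k (f ∘ g , (λ eq → g-inj (f-inj eq)) , agree)

nonempty⇒≥1 : ∀ {n} → Fin n → n ≥ 1
nonempty⇒≥1 zero    = s≤s z≤n
nonempty⇒≥1 (suc _) = s≤s z≤n

module Halves {n} {G : Graph n} (S : Split G) where
  open Split S hiding (left; right)
  open Split S using () renaming (left to l₀; right to r₀)
  Π : Partition side
  Π = partition side
  open Partition Π public

  i₀ : Fin a
  i₀ with located l₀ | left-side
  ... | left i  | _  = i
  ... | right j | eq = ⊥-elim (true≢false eq (inr-side j))

  j₀ : Fin b
  j₀ with located r₀ | right-side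
  ... | left i  | eq = ⊥-elim (true≢false (inl-side i) eq)
  ... | right j | _  = j

-- Induction on the number of vertices. The halves of a split are both nonempty and hence both
-- smaller; one vertex is a case of its own, because nothing remains after removing a universal
-- vertex.
free⇒weighted : ∀ {n} (G : Graph n) → Fin n → Free G → Acc _<_ n → Weighted G
free⇒weighted {n} G v₀ free (acc rec) with Decomposition.structure G free
... | matched mate = MatchedWeight.weighted G v₀ λ v → let r , m , _ = mate v in r , m
... | split S = SplitWeight.join-weighted G S Π
    (free⇒weighted _ i₀ (free-induced G inl inl-injective free) (rec (≤-trans (m<m+n a (nonempty⇒≥1 j₀)) (≤-reflexive (≡-sym size)))))
    (free⇒weighted _ j₀ (free-induced G inr inr-injective free) (rec (≤-trans (m<n+m b (nonempty⇒≥1 i₀)) (≤-reflexive (≡-sym size)))))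
  where open Halves S
free⇒weighted {suc zero} G v₀ free (acc rec) | universal u univ = single-weighted G
free⇒weighted {suc (suc m)} G v₀ free (acc rec) | universal u univ =
  UniversalVertex.add-weighted G u univ (free⇒weighted _ zero (free-induced G (punchIn u) (λ {i} {j} → punchIn-injective u i j) free) (rec (n<1+n (suc m))))

free⇒her : ∀ {n} (G : Graph n) → Free G → HerEquidominating G
free⇒her G free m f f-inj = Weighted⇒Equidominating (induced G f) (free⇒weighted _ zero (free-induced G f f-inj free) (<-wellFounded _))

-- Forbidden subgraphs are not equidominating

dominating-mono : ∀ {n} (G : Graph n) {D E} → D ⊆ E → Dominating G D → Dominating G E
dominating-mono G D⊆E dom v = Sum.map D⊆E (λ (u , u∈ , uv) → u , D⊆E u∈ , uv) (dom v)

-- Domination is monotone, so minimality can be tested by removing single vertices. In this form it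
-- is decidable and can be evaluated on the concrete graphs.
Minimal : ∀ {n} → Graph n → Subset n → Set
Minimal G D = Dominating G D × (∀ v → v ∈ D → ¬ Dominating G (D - v))

dominating? : ∀ {n} (G : Graph n) D → Dec (Dominating G D)
dominating? G D = all? λ v → (v ∈? D) ⊎-dec any? λ u → (u ∈? D) ×-dec (adj G u v Bool.≟ true)

minimal? : ∀ {n} (G : Graph n) D → Dec (Minimal G D)
minimal? G D = dominating? G D ×-dec all? λ v → (v ∈? D) →-dec ¬? (dominating? G (D - v))

MDS⇒Minimal : ∀ {n} (G : Graph n) {D} → MDS G D → Minimal G D
MDS⇒Minimal G {D} (dom , min) = dom , λ v v∈ dom′ →
  let _ , _ , x∈D , x∉D-v = x∈p⇒p-x⊂p v∈ in x∉D-v (min (D - v) (p─q⊆p D _) dom′ x∈D)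

Minimal⇒MDS : ∀ {n} (G : Graph n) {D} → Minimal G D → MDS G D
Minimal⇒MDS G {D} (dom , irr) = dom , λ E E⊆D dom′ {v} v∈ → decidable-stable (v ∈? E) λ v∉ →
  irr v v∈ (dominating-mono G (λ {x} x∈ → x∈p∧x≢y⇒x∈p-y (E⊆D x∈) λ { refl → v∉ x∈ }) dom′)

indicator : Bool → ℕ
indicator b = if b then 1 else 0

Balanced : ∀ {n} → Subset n → Subset n → Subset n → Subset n → Set
Balanced A B C D = ∀ i → indicator (lookup A i) + indicator (lookup B i) ≡ indicator (lookup C i) + indicator (lookup D i)

wsum-linear : ∀ {n} (w : Fin n → ℕ) A B → wsum w A + wsum w B ≡ sum λ i → (indicator (lookup A i) + indicator (lookup B i)) * w i
wsum-linear w A B = trans (cong₂ _+_ (wsum≡weight w A) (wsum≡weight w B)) (trans (≡-sym (∑-distrib-+ (λ i → if lookup A i then w i else 0) _))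
  (sum-cong-≗ λ i → trans (cong₂ _+_ (if≡* (lookup A i) (w i)) (if≡* (lookup B i) (w i))) (≡-sym (*-distribʳ-+ (w i) (indicator (lookup A i)) _))))
  where
  if≡* : ∀ b x → (if b then x else 0) ≡ indicator b * x
  if≡* true  x = ≡-sym (+-identityʳ x)
  if≡* false x = refl

balanced⇒wsum : ∀ {n} (w : Fin n → ℕ) A B C D → Balanced A B C D → wsum w A + wsum w B ≡ wsum w C + wsum w D
balanced⇒wsum w A B C D bal = trans (wsum-linear w A B) (trans (sum-cong-≗ λ i → cong (_* w i) (bal i)) (≡-sym (wsum-linear w C D)))

-- Three minimal dominating sets A, B, C with A + B = C + D force the set D to have
-- the same weight as they do.
Obstruction : ∀ {n} → Graph n → Subset n → Subset n → Subset n → Subset n → Set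
Obstruction G A B C D = Minimal G A × Minimal G B × Minimal G C × ¬ Minimal G D × Balanced A B C D

obstruction? : ∀ {n} (G : Graph n) A B C D → Dec (Obstruction G A B C D)
obstruction? G A B C D = minimal? G A ×-dec minimal? G B ×-dec minimal? G C ×-dec ¬? (minimal? G D) ×-dec all? λ i → _ ℕ.≟ _

obstruction⇒¬equidominating : ∀ {n} (G : Graph n) {A B C D} → Obstruction G A B C D → ¬ Equidominating G
obstruction⇒¬equidominating G {A} {B} {C} {D} (minA , minB , minC , ¬minD , bal) (t , _ , w , _ , mds⇔t) =
  ¬minD (MDS⇒Minimal G (proj₂ (mds⇔t D) wD))
  where
  weigh : ∀ {X} → Minimal G X → wsum w X ≡ t
  weigh {X} min = proj₁ (mds⇔t X) (Minimal⇒MDS G min)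
  wD : wsum w D ≡ t
  wD = +-cancelˡ-≡ t (wsum w D) t (trans (cong (_+ wsum w D) (≡-sym (weigh minC)))
         (trans (≡-sym (balanced⇒wsum w A B C D bal)) (cong₂ _+_ (weigh minA) (weigh minB))))

pattern ● = inside
pattern ○ = outside

-- In the bull and in K₂,₃ the set D dominates but has a redundant member; in the other five graphs
-- D leaves a vertex undominated.
forbidden-obstruction : ∀ k → ∃₂ λ A B → ∃₂ λ C D → Obstruction (Forbidden k) A B C D
forbidden-obstruction 0F = _ , _ , _ , _ ,
  from-yes (obstruction? P5 (○ ∷ ● ∷ ○ ∷ ○ ∷ ● ∷ [])
    (● ∷ ○ ∷ ○ ∷ ● ∷ ○ ∷ [])
    (○ ∷ ● ∷ ○ ∷ ● ∷ ○ ∷ [])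
    (● ∷ ○ ∷ ○ ∷ ○ ∷ ● ∷ []))
forbidden-obstruction 1F = _ , _ , _ , _ ,
  from-yes (obstruction? C5 (○ ∷ ○ ∷ ● ∷ ○ ∷ ● ∷ [])
    (○ ∷ ● ∷ ○ ∷ ● ∷ ○ ∷ [])
    (○ ∷ ● ∷ ○ ∷ ○ ∷ ● ∷ [])
    (○ ∷ ○ ∷ ● ∷ ● ∷ ○ ∷ []))
forbidden-obstruction 2F = _ , _ , _ , _ ,
  from-yes (obstruction? bull (○ ∷ ○ ∷ ● ∷ ● ∷ ● ∷ [])
    (● ∷ ● ∷ ○ ∷ ○ ∷ ○ ∷ [])
    (○ ∷ ● ∷ ○ ∷ ● ∷ ○ ∷ [])
    (● ∷ ○ ∷ ● ∷ ○ ∷ ● ∷ []))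
forbidden-obstruction 3F = _ , _ , _ , _ ,
  from-yes (obstruction? banner (○ ∷ ○ ∷ ● ∷ ○ ∷ ● ∷ [])
    (● ∷ ○ ∷ ○ ∷ ● ∷ ○ ∷ [])
    (● ∷ ○ ∷ ● ∷ ○ ∷ ○ ∷ [])
    (○ ∷ ○ ∷ ○ ∷ ● ∷ ● ∷ []))
forbidden-obstruction 4F = _ , _ , _ , _ ,
  from-yes (obstruction? house (○ ∷ ○ ∷ ○ ∷ ● ∷ ● ∷ [])
    (● ∷ ● ∷ ○ ∷ ○ ∷ ○ ∷ [])
    (○ ∷ ● ∷ ○ ∷ ● ∷ ○ ∷ [])
    (● ∷ ○ ∷ ○ ∷ ○ ∷ ● ∷ []))
forbidden-obstruction 5F = _ , _ , _ , _ ,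
  from-yes (obstruction? K23 (○ ∷ ○ ∷ ● ∷ ● ∷ ● ∷ [])
    (● ∷ ● ∷ ○ ∷ ○ ∷ ○ ∷ [])
    (○ ∷ ● ∷ ○ ∷ ○ ∷ ● ∷ [])
    (● ∷ ○ ∷ ● ∷ ● ∷ ○ ∷ []))
forbidden-obstruction 6F = _ , _ , _ , _ ,
  from-yes (obstruction? coP2P3 (○ ∷ ○ ∷ ○ ∷ ● ∷ ● ∷ [])
    (○ ∷ ● ∷ ● ∷ ○ ∷ ○ ∷ [])
    (○ ∷ ● ∷ ○ ∷ ● ∷ ○ ∷ [])
    (○ ∷ ○ ∷ ● ∷ ○ ∷ ● ∷ []))

dominating-resp : ∀ {n} (G H : Graph n) → (∀ i j → adj G i j ≡ adj H i j) → ∀ {D} → Dominating G D → Dominating H D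
dominating-resp G H G≗H dom v = Sum.map id (λ (u , u∈ , uv) → u , u∈ , trans (≡-sym (G≗H u v)) uv) (dom v)

MDS-resp : ∀ {n} (G H : Graph n) → (∀ i j → adj G i j ≡ adj H i j) → ∀ {D} → MDS G D → MDS H D
MDS-resp G H G≗H (dom , min) = dominating-resp G H G≗H dom , λ E E⊆D domE →
  min E E⊆D (dominating-resp H G (λ i j → ≡-sym (G≗H i j)) domE)

equidominating-resp : ∀ {n} (G H : Graph n) → (∀ i j → adj G i j ≡ adj H i j) → Equidominating G → Equidominating H
equidominating-resp G H G≗H (t , t≥1 , w , w≥1 , mds⇔t) = t , t≥1 , w , w≥1 , λ D →
  (λ mds → proj₁ (mds⇔t D) (MDS-resp H G (λ i j → ≡-sym (G≗H i j)) mds)) , (λ eq → MDS-resp G H G≗H (proj₂ (mds⇔t D) eq))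

her⇒free : ∀ {n} (G : Graph n) → HerEquidominating G → Free G
her⇒free G her k (f , f-inj , agree) with forbidden-obstruction k
... | _ , _ , _ , _ , obs =
  -- The argument 4 stands for five vertices, since `HerEquidominating` counts from one. The induced
  -- copy has only pointwise the same adjacency, hence the transport.
  obstruction⇒¬equidominating (Forbidden k) obs (equidominating-resp (induced G f) (Forbidden k) agree (her 4 f f-inj))

-- The constructions of (c) create no forbidden subgraph

free-iso : ∀ {n k} (G : Graph n) (H : Graph k) → Iso G H → Free H → Free G
free-iso G H (f , (f-inj , _) , f-agree) free k (g , g-inj , g-agree) =
  free k (f ∘ g , (λ eq → g-inj (f-inj eq)) , λ i j → trans (f-agree (g i) (g j)) (g-agree i j))

K1-free : Free K1
K1-free k (f , f-inj , _) with f-inj {0F} {1F} (all-equal (f 0F) (f 1F))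
  where
  all-equal : ∀ (x y : Fin 1) → x ≡ y
  all-equal zero zero = refl
... | ()

TwoNonneighbours : ∀ {n} → Graph n → Set
TwoNonneighbours H = ∃ λ i → ∃₂ λ j l → i ≢ j × i ≢ l × j ≢ l × adj H i j ≡ false × adj H i l ≡ false

-- This separates the forbidden graphs from K₂ₙ - ne, where a vertex has only one nonneighbour.
forbidden-two-nonneighbours : ∀ k → TwoNonneighbours (Forbidden k)
forbidden-two-nonneighbours = from-yes (all? λ k → any? λ i → any? λ j → any? λ l →
  ¬? (i ≟ j) ×-dec ¬? (i ≟ l) ×-dec ¬? (j ≟ l) ×-dec (adj (Forbidden k) i j Bool.≟ false) ×-dec (adj (Forbidden k) i l Bool.≟ false))

pigeonhole₂ : ∀ {a b c} → a < 2 → b < 2 → c < 2 → a ≡ b ⊎ a ≡ c ⊎ b ≡ c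
pigeonhole₂ (s≤s z≤n) (s≤s z≤n) _ = inj₁ refl
pigeonhole₂ (s≤s z≤n) (s≤s (s≤s z≤n)) (s≤s z≤n) = inj₂ (inj₁ refl)
pigeonhole₂ (s≤s z≤n) (s≤s (s≤s z≤n)) (s≤s (s≤s z≤n)) = inj₂ (inj₂ refl)
pigeonhole₂ (s≤s (s≤s z≤n)) (s≤s z≤n) (s≤s z≤n) = inj₂ (inj₂ refl)
pigeonhole₂ (s≤s (s≤s z≤n)) (s≤s z≤n) (s≤s (s≤s z≤n)) = inj₂ (inj₁ refl)
pigeonhole₂ (s≤s (s≤s z≤n)) (s≤s (s≤s z≤n)) _ = inj₁ refl

-- Numbers with equal halves are determined by their remainders modulo 2, and among three remainders
-- two agree.
same-half : ∀ x y z → x / 2 ≡ y / 2 → x / 2 ≡ z / 2 → x ≡ y ⊎ x ≡ z ⊎ y ≡ z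
same-half x y z xy xz = Sum.map (same xy) (Sum.map (same xz) (same (trans (≡-sym xy) xz)))
  (pigeonhole₂ (m%n<n x 2) (m%n<n y 2) (m%n<n z 2))
  where
  same : ∀ {u v} → u / 2 ≡ v / 2 → u % 2 ≡ v % 2 → u ≡ v
  same {u} {v} q r = trans (m≡m%n+[m/n]*n u 2) (trans (cong₂ (λ a b → a + b * 2) r q) (≡-sym (m≡m%n+[m/n]*n v 2)))

K2n-ne-free : ∀ k → Free (K2n-ne k)
K2n-ne-free k l (f , f-inj , agree) with forbidden-two-nonneighbours l
... | x , y , z , x≢y , x≢z , y≢z , xy , xz =
  [ x≢y ∘ injective , [ x≢z ∘ injective , y≢z ∘ injective ]′ ]′
    (same-half (toℕ (f x)) (toℕ (f y)) (toℕ (f z)) (half (trans (agree x y) xy)) (half (trans (agree x z) xz)))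
  where
  injective : ∀ {i j} → toℕ (f i) ≡ toℕ (f j) → i ≡ j
  injective = f-inj ∘ toℕ-injective
  half : ∀ {a b} → not (a ≡ᵇ b) ≡ false → a ≡ b
  half {a} {b} eq = ≡ᵇ⇒≡ a b (subst T (≡-sym (Bool.not-injective eq)) _)

forbidden-no-universal : ∀ k i → ∃ λ j → i ≢ j × adj (Forbidden k) i j ≡ false
forbidden-no-universal = from-yes (all? λ k → all? λ i → any? λ j → ¬? (i ≟ j) ×-dec (adj (Forbidden k) i j Bool.≟ false))

-- No forbidden graph has a universal vertex, so an embedding avoids the added one and descends to
-- `H`.
addUniversal-free : ∀ {n} (H : Graph n) → Free H → Free (addUniversal H)
addUniversal-free H free k (f , f-inj , agree) with any? (λ i → f i ≟ zero)
... | yes (i , fi≡0) with forbidden-no-universal k i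
...   | j , i≢j , ij with f j in fj | trans (≡-sym (cong (λ x → adj (addUniversal H) x (f j)) fi≡0)) (trans (agree i j) ij)
...     | zero  | _  = i≢j (f-inj (trans fi≡0 (≡-sym fj)))
...     | suc _ | ()
addUniversal-free H free k (f , f-inj , agree) | no no-zero = free k (proj₁ ∘ lower , injective , agree′)
  where
  lower : ∀ i → ∃ λ x → f i ≡ suc x
  lower i with f i in eq
  ... | zero  = ⊥-elim (no-zero (i , eq))
  ... | suc x = x , refl
  injective : Injective _≡_ _≡_ (proj₁ ∘ lower)
  injective {i} {j} eq = f-inj (trans (proj₂ (lower i)) (trans (cong suc eq) (≡-sym (proj₂ (lower j)))))
  agree′ : ∀ i j → adj H (proj₁ (lower i)) (proj₁ (lower j)) ≡ adj (Forbidden k) i j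
  agree′ i j = trans (≡-sym (cong₂ (adj (addUniversal H)) (proj₂ (lower i)) (proj₂ (lower j)))) (agree i j)

-- Chain-joins without forbidden subgraphs

Crossing : ∀ {n} → Graph n → Subset n → Fin n → Fin n → Set
Crossing H s i j = lookup s i ≡ true × lookup s j ≡ false × adj H i j ≡ true

crossing? : ∀ {n} (H : Graph n) s i j → Dec (Crossing H s i j)
crossing? H s i j = (lookup s i Bool.≟ true) ×-dec (lookup s j Bool.≟ false) ×-dec (adj H i j Bool.≟ true)

MissesLeft MissesRight : ∀ {n} → Graph n → Subset n → Fin n → Fin n → Set
MissesLeft  H s i k = lookup s k ≡ true × i ≢ k × adj H i k ≡ false
MissesRight H s j k = lookup s k ≡ false × j ≢ k × adj H j k ≡ false

Incomparable : ∀ {n} → Graph n → Subset n → Fin n → Fin n → Fin n → Fin n → Set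
Incomparable H s i j k l = Crossing H s k l × adj H i l ≡ false × adj H k j ≡ false

-- The ways in which a set s of vertices fails to be one side of a chain-join.
Violation : ∀ {n} → Graph n → Subset n → Set
Violation H s =
    (∀ i → lookup s i ≡ true)
  ⊎ (∀ i → lookup s i ≡ false)
  ⊎ (∃₂ λ i j → Crossing H s i j ×
      (∃ (MissesLeft H s i) ⊎ ∃ (MissesRight H s j) ⊎ ∃₂ (Incomparable H s i j)))

violation? : ∀ {n} (H : Graph n) s → Dec (Violation H s)
violation? H s =
  all? (λ i → lookup s i Bool.≟ true) ⊎-dec all? (λ i → lookup s i Bool.≟ false) ⊎-dec
  any? λ i → any? λ j → crossing? H s i j ×-dec
    (any? (λ k → (lookup s k Bool.≟ true) ×-dec ¬? (i ≟ k) ×-dec (adj H i k Bool.≟ false)) ⊎-dec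
     any? (λ k → (lookup s k Bool.≟ false) ×-dec ¬? (j ≟ k) ×-dec (adj H j k Bool.≟ false)) ⊎-dec
     any? λ k → any? λ l → crossing? H s k l ×-dec (adj H i l Bool.≟ false) ×-dec (adj H k j Bool.≟ false))

-- A finite check of all 32 vertex subsets of each graph. The double negation is the form in which
-- `anySubset?` decides a statement about all subsets.
forbidden-violation : ∀ k → ¬ ∃ λ s → ¬ Violation (Forbidden k) s
forbidden-violation = from-yes (all? λ k → ¬? (anySubset? λ s → ¬? (violation? (Forbidden k) s)))

module ChainJoin {a b} (G₁ : Graph a) (G₂ : Graph b) (B : Fin a → Fin b → Bool) where

  J : Graph (a + b)
  J = joinWith G₁ G₂ B

  adj-left : ∀ x y → adj J (x ↑ˡ b) (y ↑ˡ b) ≡ adj G₁ x y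
  adj-left x y rewrite splitAt-↑ˡ a x b | splitAt-↑ˡ a y b = refl

  adj-right : ∀ x y → adj J (a ↑ʳ x) (a ↑ʳ y) ≡ adj G₂ x y
  adj-right x y rewrite splitAt-↑ʳ a b x | splitAt-↑ʳ a b y = refl

  adj-cross : ∀ x y → adj J (x ↑ˡ b) (a ↑ʳ y) ≡ B x y
  adj-cross x y rewrite splitAt-↑ˡ a x b | splitAt-↑ʳ a b y = refl

  isLeft : Fin (a + b) → Bool
  isLeft v = [ (λ _ → true) , (λ _ → false) ]′ (splitAt a v)

  left-of : ∀ v → isLeft v ≡ true → ∃ λ x → v ≡ x ↑ˡ b
  left-of v eq with splitAt a v | join-splitAt a b v
  ... | inj₁ x | v≡ = x , ≡-sym v≡
  left-of v () | inj₂ y | _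

  right-of : ∀ v → isLeft v ≡ false → ∃ λ y → v ≡ a ↑ʳ y
  right-of v eq with splitAt a v | join-splitAt a b v
  ... | inj₂ y | v≡ = y , ≡-sym v≡
  right-of v () | inj₁ x | _

  -- Let `s` be the part of an embedded forbidden graph that lands in the first block. It has no
  -- violation: neither block contains the whole copy, the ends of a crossing edge are universal in
  -- their sides, and the chain condition forbids incomparable neighbourhoods.
  chainJoin-free : Free G₁ → Free G₂ → IsChainGraphOnUniversals G₁ G₂ B → Free J
  chainJoin-free free₁ free₂ (universals , chain , _) k (f , f-inj , agree) =
    forbidden-violation k (s , ¬violation)
    where
    H = Forbidden k
    s = tabulate (isLeft ∘ f)
    leftʳ : ∀ {i} → lookup s i ≡ true → ∃ λ x → f i ≡ x ↑ˡ b
    leftʳ {i} eq = left-of (f i) (trans (≡-sym (lookup∘tabulate (isLeft ∘ f) i)) eq)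
    rightʳ : ∀ {i} → lookup s i ≡ false → ∃ λ y → f i ≡ a ↑ʳ y
    rightʳ {i} eq = right-of (f i) (trans (≡-sym (lookup∘tabulate (isLeft ∘ f) i)) eq)

    H-adj : ∀ {i j u v} → f i ≡ u → f j ≡ v → adj H i j ≡ adj J u v
    H-adj {i} {j} eq eq′ = trans (≡-sym (agree i j)) (cong₂ (adj J) eq eq′)

    B-adj : ∀ {i j x y} → f i ≡ x ↑ˡ b → f j ≡ a ↑ʳ y → adj H i j ≡ B x y
    B-adj eq eq′ = trans (H-adj eq eq′) (adj-cross _ _)

    ¬violation : ¬ Violation H s
    ¬violation (inj₁ all-left) = free₁ k (g , g-inj , λ i j → trans (≡-sym (adj-left _ _)) (≡-sym (H-adj (eq i) (eq j))))
      where
      g : Fin 5 → Fin a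
      g i = proj₁ (leftʳ (all-left i))
      eq : ∀ i → f i ≡ g i ↑ˡ b
      eq i = proj₂ (leftʳ (all-left i))
      g-inj : Injective _≡_ _≡_ g
      g-inj {i} {j} gi≡gj = f-inj (trans (eq i) (trans (cong (_↑ˡ b) gi≡gj) (≡-sym (eq j))))
    ¬violation (inj₂ (inj₁ all-right)) = free₂ k (g , g-inj , λ i j → trans (≡-sym (adj-right _ _)) (≡-sym (H-adj (eq i) (eq j))))
      where
      g : Fin 5 → Fin b
      g i = proj₁ (rightʳ (all-right i))
      eq : ∀ i → f i ≡ a ↑ʳ g i
      eq i = proj₂ (rightʳ (all-right i))
      g-inj : Injective _≡_ _≡_ g
      g-inj {i} {j} gi≡gj = f-inj (trans (eq i) (trans (cong (a ↑ʳ_) gi≡gj) (≡-sym (eq j))))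
    ¬violation (inj₂ (inj₂ (i , j , (si , sj , ij) , failure))) = refute failure
      where
      x = proj₁ (leftʳ si)
      fi = proj₂ (leftʳ si)
      y = proj₁ (rightʳ sj)
      fj = proj₂ (rightʳ sj)
      Bxy : B x y ≡ true
      Bxy = trans (≡-sym (B-adj fi fj)) ij

      refute : ¬ (∃ (MissesLeft H s i) ⊎ ∃ (MissesRight H s j) ⊎ ∃₂ (Incomparable H s i j))
      refute (inj₁ (k , sk , i≢k , ik)) with leftʳ sk
      ... | z , fk = true≢false (proj₁ (universals x y Bxy) z λ { refl → i≢k (f-inj (trans fi (≡-sym fk))) })
                       (trans (≡-sym (adj-left x z)) (trans (≡-sym (H-adj fi fk)) ik))
      refute (inj₂ (inj₁ (k , sk , j≢k , jk))) with rightʳ sk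
      ... | z , fk = true≢false (proj₂ (universals x y Bxy) z λ { refl → j≢k (f-inj (trans fj (≡-sym fk))) })
                       (trans (≡-sym (adj-right y z)) (trans (≡-sym (H-adj fj fk)) jk))
      refute (inj₂ (inj₂ (k , l , (sk , sl , kl) , il , kj))) with leftʳ sk | rightʳ sl
      ... | z , fk | w , fl = [ (λ sub → true≢false (sub y Bxy) (trans (≡-sym (B-adj fk fj)) kj))
                              , (λ sub → true≢false (sub w Bzw) (trans (≡-sym (B-adj fi fl)) il)) ]′
                              (chain x z (proj₁ (universals x y Bxy)) (proj₁ (universals z w Bzw)))
        where
        Bzw : B z w ≡ true
        Bzw = trans (≡-sym (B-adj fk fl)) kl

conditionC⇒free : ∀ {n} (G : Graph n) → ConditionC G → Free G
conditionC⇒free G (inj₁ (inj₁ iso)) = free-iso G K1 iso K1-free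
conditionC⇒free G (inj₁ (inj₂ (k , _ , iso))) = free-iso G (K2n-ne k) iso (K2n-ne-free k)
conditionC⇒free G (inj₂ (inj₁ (m , H , her , iso))) = free-iso G (addUniversal H) iso (addUniversal-free H (her⇒free H her))
conditionC⇒free G (inj₂ (inj₂ (a , b , G₁ , G₂ , her₁ , her₂ , B , chain , iso))) =
  free-iso G (joinWith G₁ G₂ B) iso (ChainJoin.chainJoin-free G₁ G₂ B (her⇒free G₁ her₁) (her⇒free G₂ her₂) chain)

-- Isomorphisms for (c)

iso-from : ∀ {n k} (G : Graph n) (H : Graph k) (g : Fin k → Fin n) → Injective _≡_ _≡_ g → (∀ v → ∃ λ i → g i ≡ v) →
  (∀ i j → adj G (g i) (g j) ≡ adj H i j) → Iso G H
iso-from G H g g-inj g-surj agree = f , (f-inj , f-surj) , λ i j →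
  trans (≡-sym (agree (f i) (f j))) (cong₂ (adj G) (gf i) (gf j))
  where
  f = λ v → proj₁ (g-surj v)
  gf : ∀ v → g (f v) ≡ v
  gf v = proj₂ (g-surj v)
  f-inj : Injective _≡_ _≡_ f
  f-inj {u} {v} eq = trans (≡-sym (gf u)) (trans (cong g eq) (gf v))
  f-surj : ∀ i → ∃ λ v → ∀ {u} → u ≡ v → f u ≡ i
  f-surj i = g i , λ { refl → g-inj (gf (g i)) }

module _ {m} (G : Graph (suc m)) (u : Fin (suc m)) (univ : Universal G u) where

  private
    g : Fin (suc m) → Fin (suc m)
    g zero    = u
    g (suc j) = punchIn u j

    g-inj : Injective _≡_ _≡_ g
    g-inj {zero}  {zero}  _  = refl
    g-inj {zero}  {suc j} eq = ⊥-elim (punchInᵢ≢i u j (≡-sym eq))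
    g-inj {suc i} {zero}  eq = ⊥-elim (punchInᵢ≢i u i eq)
    g-inj {suc i} {suc j} eq = cong suc (punchIn-injective u i j eq)

    g-surj : ∀ v → ∃ λ i → g i ≡ v
    g-surj v with punchView u v
    ... | here    = zero , refl
    ... | there j = suc j , refl

    H : Graph m
    H = induced G (punchIn u)

    agree : ∀ i j → adj G (g i) (g j) ≡ adj (addUniversal H) i j
    agree zero    zero    = irrefl G u
    agree zero    (suc j) = univ _ (punchInᵢ≢i u j ∘ ≡-sym)
    agree (suc i) zero    = trans (sym G _ u) (univ _ (punchInᵢ≢i u i ∘ ≡-sym))
    agree (suc i) (suc j) = refl

  universal-iso : Iso G (addUniversal H)
  universal-iso = iso-from G (addUniversal H) g g-inj g-surj agree

module SplitIso {n} (G : Graph n) (free : Free G) (S : Split G) where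
  open Split S hiding (left; right)
  open Split S using () renaming (left to l₀; right to r₀)
  open Halves S
  open Decomposition G free using (C4; mkC4; C4-module)

  G₁ : Graph a
  G₁ = induced G inl

  G₂ : Graph b
  G₂ = induced G inr

  B : Fin a → Fin b → Bool
  B x y = adj G (inl x) (inr y)

  universals : ∀ x y → B x y ≡ true → Universal G₁ x × Universal G₂ y
  universals x y xy =
      (λ z x≢z → cross-left (inl-side x) (inr-side y) xy (inl z) (inl-side z) (x≢z ∘ inl-injective))
    , (λ z y≢z → cross-right (inl-side x) (inr-side y) xy (inr z) (inr-side z) (y≢z ∘ inr-injective))

  -- The ends of two crossing edges with no other edges between the sides form a C₄, of
  -- which the vertex l₀ sees only one half.
  comparable : ∀ x x′ y y′ → B x y ≡ true → B x′ y′ ≡ true → B x y′ ≡ false → B x′ y ≡ false → ⊥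
  comparable x x′ y y′ xy x′y′ xy′ x′y = true≢false (proj₁ (C4-module square l₀x l₀≢y l₀≢x′)) (left-private (inr y) (inr-side y))
    where
    separate : ∀ {p q r} → adj G (inl p) r ≡ true → adj G (inl q) r ≡ false → inl p ≢ inl q
    separate pr qr eq = true≢false pr (trans (cong (λ v → adj G v _) eq) qr)
    l₀≢ : ∀ {p q} → B p q ≡ true → l₀ ≢ inl p
    l₀≢ {p} {q} pq refl = true≢false pq (left-private (inr q) (inr-side q))
    x≢x′ = separate {x} {x′} xy x′y
    y≢y′ : inr y ≢ inr y′
    y≢y′ eq = true≢false xy (trans (cong (adj G (inl x)) eq) xy′)
    xx′ = cross-left (inl-side x) (inr-side y) xy (inl x′) (inl-side x′) x≢x′
    yy′ = cross-right (inl-side x) (inr-side y) xy (inr y′) (inr-side y′) y≢y′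
    square : C4 (inl x) (inr y) (inr y′) (inl x′)
    square = mkC4 xy yy′ (trans (sym G _ _) x′y′) (trans (sym G _ _) xx′) xy′ (trans (sym G _ _) x′y)
      (λ eq → sides-differ eq) (λ eq → sides-differ (≡-sym eq))
      where
      sides-differ : ∀ {p q} → inl p ≢ inr q
      sides-differ {p} {q} eq = true≢false (inl-side p) (trans (cong side eq) (inr-side q))
    l₀x = trans (sym G _ _) (cross-left (inl-side x) (inr-side y) xy l₀ left-side (l₀≢ xy ∘ ≡-sym))
    l₀≢y : l₀ ≢ inr y
    l₀≢y eq = true≢false left-side (trans (cong side eq) (inr-side y))
    l₀≢x′ = l₀≢ x′y′

  chain : IsChainGraphOnUniversals G₁ G₂ B
  chain = universals , left-chain , right-chain
    where
    left-chain : ∀ x x′ → Universal G₁ x → Universal G₁ x′ →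
      (∀ y → B x y ≡ true → B x′ y ≡ true) ⊎ (∀ y → B x′ y ≡ true → B x y ≡ true)
    left-chain x x′ _ _ with any? (λ y → (B x y Bool.≟ true) ×-dec (B x′ y Bool.≟ false))
    ... | no none = inj₁ λ y xy → Bool.¬-not λ x′y → none (y , xy , x′y)
    ... | yes (y , xy , x′y) = inj₂ λ y′ x′y′ → Bool.¬-not λ xy′ → comparable x x′ y y′ xy x′y′ xy′ x′y
    right-chain : ∀ y y′ → Universal G₂ y → Universal G₂ y′ →
      (∀ x → B x y ≡ true → B x y′ ≡ true) ⊎ (∀ x → B x y′ ≡ true → B x y ≡ true)
    right-chain y y′ _ _ with any? (λ x → (B x y Bool.≟ true) ×-dec (B x y′ Bool.≟ false))
    ... | no none = inj₁ λ x xy → Bool.¬-not λ xy′ → none (x , xy , xy′)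
    ... | yes (x , xy , xy′) = inj₂ λ x′ x′y′ → Bool.¬-not λ x′y → comparable x x′ y y′ xy x′y′ xy′ x′y

  private
    g : Fin (a + b) → Fin n
    g v = [ inl , inr ]′ (splitAt a v)

    locate-g : ∀ v → locate (g v) ≡ splitAt a v
    locate-g v with splitAt a v
    ... | inj₁ i = locate-inl i
    ... | inj₂ j = locate-inr j

    g-inj : Injective _≡_ _≡_ g
    g-inj {u} {v} eq = trans (≡-sym (join-splitAt a b u))
      (trans (cong (join a b) (trans (≡-sym (locate-g u)) (trans (cong locate eq) (locate-g v)))) (join-splitAt a b v))

    g-surj : ∀ v → ∃ λ i → g i ≡ v
    g-surj v = join a b (locate v) , trans (cong [ inl , inr ]′ (splitAt-join a b (locate v))) (recover v)

    agree : ∀ u v → adj G (g u) (g v) ≡ adj (joinWith G₁ G₂ B) u v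
    agree u v with splitAt a u | splitAt a v
    ... | inj₁ x | inj₁ y = refl
    ... | inj₁ x | inj₂ y = refl
    ... | inj₂ x | inj₁ y = sym G (inr x) (inl y)
    ... | inj₂ x | inj₂ y = refl

  split-iso : Iso G (joinWith G₁ G₂ B)
  split-iso = iso-from G (joinWith G₁ G₂ B) g g-inj g-surj agree

-- Matching on the sizes exposes them as successors, the form that `ConditionC` asks for; the two
-- vertices exclude size zero.
nonempty-chainJoin : ∀ {n a b} (G : Graph n) → Fin a → Fin b → (G₁ : Graph a) (G₂ : Graph b) (B : Fin a → Fin b → Bool) →
  Free G₁ → Free G₂ → IsChainGraphOnUniversals G₁ G₂ B → Iso G (joinWith G₁ G₂ B) → ConditionC G
nonempty-chainJoin {a = suc a} {suc b} G _ _ G₁ G₂ B free₁ free₂ chain iso =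
  inj₂ (inj₂ (a , b , G₁ , G₂ , free⇒her G₁ free₁ , free⇒her G₂ free₂ , B , chain , iso))

-- Recognising K₂ₙ - ne

paired-adj : ∀ {m} → Fin m → Fin m → Bool
paired-adj i j = not (toℕ i / 2 ≡ᵇ toℕ j / 2)

[2+n]/2 : ∀ n → (2 + n) / 2 ≡ suc (n / 2)
[2+n]/2 n = +-distrib-/-∣ˡ n {2} ∣-refl

paired-adj-0 : ∀ {m} (j : Fin m) → paired-adj {suc (suc m)} zero (suc (suc j)) ≡ true
paired-adj-0 j = cong (λ h → not (0 ≡ᵇ h)) ([2+n]/2 (toℕ j))

paired-adj-suc : ∀ {m} (i j : Fin m) → paired-adj {suc (suc m)} (suc (suc i)) (suc (suc j)) ≡ paired-adj i j
paired-adj-suc i j = cong₂ (λ h h′ → not (h ≡ᵇ h′)) ([2+n]/2 (toℕ i)) ([2+n]/2 (toℕ j))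

-- The adjacency of K₂ₙ - ne depends only on the numbers of the vertices, so it can be stated on
-- `Fin n` with the equation `n≡k+k` kept apart. The recursion thus needs no transport along
-- equations of sizes.
record Pairing {n} (G : Graph n) : Set where
  field
    k          : ℕ
    n≡k+k      : n ≡ k + k
    enum       : Fin n → Fin n
    injective  : Injective _≡_ _≡_ enum
    surjective : ∀ v → ∃ λ i → enum i ≡ v
    agree      : ∀ i j → adj G (enum i) (enum j) ≡ paired-adj i j

-- Vertex `zero` and its mate take positions 0 and 1. Both see all remaining vertices, so the mate
-- of a remaining vertex is again a remaining one and the recursion goes on.
pairing : ∀ {n} (G : Graph n) → (∀ v → ∃ (Mate G v)) → Pairing G
pairing {zero} G mate = record
  { k = 0 ; n≡k+k = refl ; enum = id ; injective = id ; surjective = λ () ; agree = λ () }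
pairing {suc zero} G mate with mate zero
... | zero , 0≢0 , _ = ⊥-elim (0≢0 refl)
pairing {suc (suc m)} G mate with mate zero
... | zero , 0≢0 , _ = ⊥-elim (0≢0 refl)
... | suc s , _ , 0s , only₀ = record
  { k          = suc k
  ; n≡k+k      = cong suc (trans (cong suc n≡k+k) (≡-sym (+-suc k k)))
  ; enum       = g
  ; injective  = g-inj
  ; surjective = g-surj
  ; agree      = agree′
  }
  where
  rest : Fin m → Fin (suc (suc m))
  rest j = suc (punchIn s j)

  rest≢s : ∀ j → suc s ≢ rest j
  rest≢s j eq = punchInᵢ≢i s j (≡-sym (suc-injective eq))

  zero-rest : ∀ j → adj G zero (rest j) ≡ true
  zero-rest j = Bool.¬-not λ 0j → rest≢s j (≡-sym (only₀ (rest j) (λ ()) 0j))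

  s-rest : ∀ j → adj G (suc s) (rest j) ≡ true
  -- Being mates is symmetric: `zero` is a nonneighbour of `suc s`, hence its only one.
  s-rest j = Bool.¬-not λ sj → zero≢suc (let r , _ , _ , only = mate (suc s) in
    trans (only zero (λ ()) (trans (sym G _ _) 0s)) (≡-sym (only (rest j) (rest≢s j) sj)))
    where
    zero≢suc : zero ≢ rest j
    zero≢suc ()

  mate′ : ∀ j → ∃ (Mate (induced G rest) j)
  mate′ j with mate (rest j)
  ... | zero , _ , j0 , _ = ⊥-elim (true≢false (zero-rest j) (trans (sym G _ _) j0))
  ... | suc r , j≢r , jr , only with punchView s r
  ...   | here    = ⊥-elim (true≢false (s-rest j) (trans (sym G _ _) jr))
  ...   | there i = i , (λ { refl → j≢r refl }) , jr , λ l j≢l jl →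
    punchIn-injective s l i (suc-injective (only (rest l) (j≢l ∘ punchIn-injective s j l ∘ suc-injective) jl))

  open Pairing (pairing (induced G rest) mate′)

  g : Fin (suc (suc m)) → Fin (suc (suc m))
  g zero          = zero
  g (suc zero)    = suc s
  g (suc (suc i)) = rest (enum i)

  g-inj : Injective _≡_ _≡_ g
  g-inj {zero}        {zero}        _  = refl
  g-inj {zero}        {suc zero}    ()
  g-inj {zero}        {suc (suc j)} ()
  g-inj {suc zero}    {zero}        ()
  g-inj {suc (suc i)} {zero}        ()
  g-inj {suc zero}    {suc zero}    _  = refl
  g-inj {suc zero}    {suc (suc j)} eq = ⊥-elim (rest≢s (enum j) eq)
  g-inj {suc (suc i)} {suc zero}    eq = ⊥-elim (rest≢s (enum i) (≡-sym eq))
  g-inj {suc (suc i)} {suc (suc j)} eq = cong (λ l → suc (suc l)) (injective (punchIn-injective s _ _ (suc-injective eq)))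

  g-surj : ∀ v → ∃ λ i → g i ≡ v
  g-surj zero = zero , refl
  g-surj (suc v) with punchView s v
  ... | here = suc zero , refl
  ... | there j with surjective j
  ...   | i , refl = suc (suc i) , refl

  agree′ : ∀ i j → adj G (g i) (g j) ≡ paired-adj i j
  agree′ zero          zero          = irrefl G zero
  agree′ zero          (suc zero)    = 0s
  agree′ zero          (suc (suc j)) = trans (zero-rest (enum j)) (≡-sym (paired-adj-0 j))
  agree′ (suc zero)    zero          = trans (sym G _ _) 0s
  agree′ (suc zero)    (suc zero)    = irrefl G (suc s)
  agree′ (suc zero)    (suc (suc j)) = trans (s-rest (enum j)) (≡-sym (paired-adj-0 j))
  agree′ (suc (suc i)) zero          = trans (sym G _ _) (trans (zero-rest (enum i)) (trans (≡-sym (paired-adj-0 i)) (cong not (≡ᵇ-sym 0 (toℕ (suc (suc i)) / 2)))))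
  agree′ (suc (suc i)) (suc zero)    = trans (sym G _ _) (trans (s-rest (enum i)) (trans (≡-sym (paired-adj-0 i)) (cong not (≡ᵇ-sym 0 (toℕ (suc (suc i)) / 2)))))
  agree′ (suc (suc i)) (suc (suc j)) = trans (agree i j) (≡-sym (paired-adj-suc i j))

paired-iso : ∀ {n} (G : Graph n) k → n ≡ k + k → (enum : Fin n → Fin n) → Injective _≡_ _≡_ enum →
  (∀ v → ∃ λ i → enum i ≡ v) → (∀ i j → adj G (enum i) (enum j) ≡ paired-adj i j) → Iso G (K2n-ne k)
paired-iso G k refl enum inj surj agree = iso-from G (K2n-ne k) enum inj surj agree

fin-2 : ∀ (i j l : Fin 2) → i ≡ j ⊎ i ≡ l ⊎ j ≡ l
fin-2 = from-yes (all? {2} λ i → all? {2} λ j → all? {2} λ l → (i ≟ j) ⊎-dec (i ≟ l) ⊎-dec (j ≟ l))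

-- With two vertices, `zero`, its nonneighbour and its neighbour could not be distinct.
matched⇒k≥2 : ∀ {n} (G : Graph (suc n)) → (∀ v → ∃ λ r → Mate G v r × ∃ λ p → adj G v p ≡ true) → ∀ k → suc n ≡ k + k → k ≥ 2
matched⇒k≥2 G mates zero ()
matched⇒k≥2 G mates (suc zero) refl with mates zero
... | r , (0≢r , 0r , _) , p , 0p with fin-2 zero r p
...   | inj₁ 0≡r         = ⊥-elim (0≢r 0≡r)
...   | inj₂ (inj₁ refl) = ⊥-elim (true≢false 0p (irrefl G zero))
...   | inj₂ (inj₂ refl) = ⊥-elim (true≢false 0p 0r)
matched⇒k≥2 G mates (suc (suc k)) _ = s≤s (s≤s z≤n)

free⇒conditionC : ∀ {n} (G : Graph (suc n)) → Free G → ConditionC G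
free⇒conditionC G free with Decomposition.structure G free
free⇒conditionC {zero} G free | universal _ _ =
  inj₁ (inj₁ (iso-from G K1 id id (λ v → v , refl) λ { zero zero → irrefl G zero }))
free⇒conditionC {suc m} G free | universal u univ =
  inj₂ (inj₁ (m , induced G (punchIn u) , free⇒her (induced G (punchIn u)) (free-induced G (punchIn u) (λ {i} {j} → punchIn-injective u i j) free) , universal-iso G u univ))
free⇒conditionC G free | split S =
  nonempty-chainJoin G i₀ j₀ G₁ G₂ B (free-induced G inl inl-injective free) (free-induced G inr inr-injective free) chain split-iso
  where
  open Halves S
  open SplitIso G free S
free⇒conditionC G free | matched mates =
  inj₁ (inj₂ (k , matched⇒k≥2 G mates k n≡k+k , paired-iso G k n≡k+k enum injective surjective agree))
  where
  mate : ∀ v → ∃ (Mate G v)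
  mate v = let r , m , _ = mates v in r , m
  open Pairing (pairing G mate)

theorem8p1 : ∀ {n} (G : Graph (suc n)) →
    (HerEquidominating G ⇔ FFree G) × (HerEquidominating G ⇔ ConditionC G)
theorem8p1 G =
    mk⇔ (Free⇒FFree G ∘ her⇒free G) (free⇒her G ∘ FFree⇒Free G)
  , mk⇔ (free⇒conditionC G ∘ her⇒free G) (free⇒her G ∘ conditionC⇒free G)
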